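{- The generalized reachability problem G-G-Reach is decidable for UCST[$Z,N$], i.e., for UCSTs in which the only tests (by Sender or Receiver, on either channel) are emptiness tests $Z$ and non-emptiness tests $N$.
   Context: A UCST (unidirectional channel system with tests) is a tuple $S=(\{\mathtt r,\mathtt l\},M,Q_1,\Delta_1,Q_2,\Delta_2)$ where $M$ is a finite message alphabet, $Q_1,Q_2$ are disjoint finite sets of states of Sender and Receiver respectively, and $\Delta_1,\Delta_2$ are finite sets of rules of Sender and Receiver. There are two channels: $\mathtt r$ (reliable) and $\mathtt l$ (lossy). A rule in $\Delta_i$ is a tuple $(q,\mathtt c,\alpha,q')\in Q_i\times\{\mathtt r,\mathtt l\}\times \mathrm{Act}\times Q_i$ with $\mathrm{Act}=\mathrm{Reg}(M)\cup M\cup\{\epsilon\}$, where $\mathrm{Reg}(M)$ is the set of regular languages over $M$ (finitely represented, e.g. by finite automata or regular expressions). If $\alpha=R\in\mathrm{Reg}(M)$ the rule is a test on $\mathtt c$; if $\alpha=x\in M\cup\{\epsilon\}$ it is a write $\mathtt c!x$ when in $\Delta_1$ and a read $\mathtt c?x$ when in $\Delta_2$ ($\alpha=\epsilon$ is the empty action). Configurations are tuples $(q_1,q_2,u,v)\in Q_1\times Q_2\times M^*\times M^*$ ($u$ is the content of $\mathtt r$, $v$ that of $\mathtt l$). Reliable steps: a rule $(q,\mathtt c,\alpha,q')$ of Sender (respectively Receiver) can be fired if $q$ is the current Sender (respectively Receiver) state, which becomes $q'$, the other agent's state being unchanged; a test $R$ on $\mathtt c$ requires the content of $\mathtt c$ to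 be in $R$ and changes no content; a write $\mathtt c!x$ appends $x$ at the right end of the content of $\mathtt c$; a read $\mathtt c?x$ requires $x$ to be a prefix of the content of $\mathtt c$ and removes it. Loss steps: $(q_1,q_2,u,v)\to(q_1,q_2,u,v')$ whenever $v'$ is obtained from $v$ by deleting one occurrence of a symbol. A step is a reliable step or a loss step; a run $C\xrightarrow{*}D$ is a finite sequence of chained steps. G-G-Reach: given a UCST $S$, states $p_{\mathrm{in}},p_{\mathrm{fi}}\in Q_1$, $q_{\mathrm{in}},q_{\mathrm{fi}}\in Q_2$ and regular languages $U,V,U',V'\in\mathrm{Reg}(M)$, are there $u\in U$, $v\in V$, $u'\in U'$, $v'\in V'$ such that $S$ has a run $(p_{\mathrm{in}},q_{\mathrm{in}},u,v)\xrightarrow{*}(p_{\mathrm{fi}},q_{\mathrm{fi}},u',v')$? Tests: $Z=\{\epsilon\}$ (emptiness) and $N=M^+$ (non-emptiness). -}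

module Defs where

open import Level using (0ℓ)
open import Data.Nat using (ℕ)
open import Data.Fin using (Fin)
open import Data.Fin.Properties using (≤-decTotalOrder)
open import Data.List using (List; []; _∷_; _++_; fromMaybe)
open import Data.List.Membership.Propositional using (_∈_)
open import Data.List.Relation.Unary.All using (All)
open import Data.Maybe using (Maybe)
open import Data.Product using (_×_; _,_; ∃-syntax)
open import Data.Sum using (_⊎_)
open import Data.Unit using (⊤)
open import Relation.Binary.Bundles using (DecTotalOrder)
open import Relation.Binary.Construct.Closure.ReflexiveTransitive using (Star)
open import Relation.Binary.Construct.Union using (_∪_)
open import Relation.Binary.Core using (Rel)
open import Relation.Binary.PropositionalEquality using (_≡_; _≢_)
open import Relation.Unary using (Pred; _≐_)
import Text.Regex

-- The order on Fin m only gives meaning to the library's range expressions;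
-- the languages denoted are exactly the regular languages over Fin m.
module RegExp (m : ℕ) = Text.Regex (DecTotalOrder.decPoset (≤-decTotalOrder m))

Word : ℕ → Set
Word m = List (Fin m)

Reg : ℕ → Set
Reg m = RegExp.Exp m

Language : ℕ → Set₁
Language m = Pred (Word m) 0ℓ

⟦_⟧ : ∀ {m} → Reg m → Language m
⟦_⟧ {m} R w = RegExp._∈_ m w R

Z N : ∀ {m} → Language m
Z w = w ≡ []
N w = w ≢ []

data Channel : Set where
  r l : Channel

-- comm (just a) is the symbol a and comm nothing is the empty action ε; it is
-- a write in Sender's rules and a read in Receiver's rules.
data Act (m : ℕ) : Set where
  test : Reg m → Act m
  comm : Maybe (Fin m) → Act m

Rule : (m n : ℕ) → Set
Rule m n = Fin n × Channel × Act m × Fin n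

-- The alphabet is Fin m; Sender and Receiver states are Fin n₁ and Fin n₂
-- (kept apart by the types, whence disjoint).
record UCST : Set where
  field
    m n₁ n₂ : ℕ
    Δ₁ : List (Rule m n₁)
    Δ₂ : List (Rule m n₂)

ZNTest : ∀ {m} → Act m → Set
ZNTest (test R) = ⟦ R ⟧ ≐ Z ⊎ ⟦ R ⟧ ≐ N
ZNTest (comm _) = ⊤

ZNRule : ∀ {m n} → Rule m n → Set
ZNRule (_ , _ , α , _) = ZNTest α

UCST[Z,N] : UCST → Set
UCST[Z,N] S = All ZNRule Δ₁ × All ZNRule Δ₂
  where open UCST S

-- (content of r , content of l)
Contents : ℕ → Set
Contents m = Word m × Word m

content : ∀ {m} → Channel → Contents m → Word m
content r (u , v) = u
content l (u , v) = v

setContent : ∀ {m} → Channel → Word m → Contents m → Contents m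
setContent r w (u , v) = w , v
setContent l w (u , v) = u , w

module Semantics (S : UCST) where
  open UCST S

  Config : Set
  Config = Fin n₁ × Fin n₂ × Word m × Word m

  data ReliableStep : Rel Config 0ℓ where
    sender-test : ∀ {p p′ q c R k} →
      (p , c , test R , p′) ∈ Δ₁ →
      ⟦ R ⟧ (content c k) →
      ReliableStep (p , q , k) (p′ , q , k)
    sender-write : ∀ {p p′ q c x k} →
      (p , c , comm x , p′) ∈ Δ₁ →
      ReliableStep (p , q , k)
                   (p′ , q , setContent c (content c k ++ fromMaybe x) k)
    receiver-test : ∀ {p q q′ c R k} →
      (q , c , test R , q′) ∈ Δ₂ →
      ⟦ R ⟧ (content c k) →
      ReliableStep (p , q , k) (p , q′ , k)
    receiver-read : ∀ {p q q′ c x k w} →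
      (q , c , comm x , q′) ∈ Δ₂ →
      content c k ≡ fromMaybe x ++ w →
      ReliableStep (p , q , k) (p , q′ , setContent c w k)

  data LossStep : Rel Config 0ℓ where
    loss : ∀ {p q u} (v₁ : Word m) (a : Fin m) (v₂ : Word m) →
      LossStep (p , q , u , v₁ ++ a ∷ v₂) (p , q , u , v₁ ++ v₂)

  Step : Rel Config 0ℓ
  Step = ReliableStep ∪ LossStep

  Run : Rel Config 0ℓ
  Run = Star Step

  G-G-Reach : (p-in p-fi : Fin n₁) (q-in q-fi : Fin n₂)
              (U V U′ V′ : Reg m) → Set
  G-G-Reach p-in p-fi q-in q-fi U V U′ V′ =
    ∃[ u ] ∃[ v ] ∃[ u′ ] ∃[ v′ ]
      ⟦ U ⟧ u × ⟦ V ⟧ v × ⟦ U′ ⟧ u′ × ⟦ V′ ⟧ v′ ×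
      Run (p-in , q-in , u , v) (p-fi , q-fi , u′ , v′)

{-# OPTIONS --safe #-}
module Submission where

open import Level using (0ℓ)
open import Defs hiding (r; l)
open import Data.Bool using (Bool; true; false)
open import Data.Empty using (⊥)
open import Data.Fin using (Fin; zero; suc; #_; combine; punchIn; punchOut) renaming (_≟_ to _≟ᶠ_)
open import Data.Fin.Properties using (any?; combine-injective; punchIn-punchOut; ≤-decTotalOrder; +↔⊎; 0↔⊥; 1↔⊤)
open import Data.List using (List; []; _∷_; _++_; map; length; allFin; cartesianProduct; cartesianProductWith)
open import Data.List.Membership.Propositional using (find) renaming (_∈_ to _∈ˡ_)
open import Data.List.Membership.Propositional.Properties using (∈-allFin; ∈-cartesianProduct⁺; ∈-cartesianProductWith⁺)
open import Data.List.Properties using (length-++; ++-assoc; ++-identityʳ; ≡-dec)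
open import Data.List.Relation.Binary.Sublist.Propositional using (_⊆_; []; _∷_; _∷ʳ_; ⊆-refl; ⊆-trans; minimum)
open import Data.List.Relation.Binary.Sublist.Propositional.Properties using (map⁺; ++⁺; ++⁺ˡ; ++⁺ʳ)
open import Data.List.Relation.Ternary.Appending.Propositional using (break) renaming (_++_ to _++ᵃ_)
open import Data.List.Relation.Unary.All as All using (All)
open import Data.List.Relation.Unary.Any as Any using (Any; here; there)
open import Data.Maybe using (Maybe; just; nothing)
open import Data.Nat using (ℕ; zero; suc; pred; _+_; _≤_; _<_; z≤n; s≤s; s≤s⁻¹; _≤?_)
open import Data.Nat.Induction using (<-wellFounded; Acc; acc)
open import Data.Nat.Properties using (≤-refl; ≤-trans; ≤-antisym; ≤-reflexive; ≤-<-trans; n≤1+n; m≤m+n; m≤n+m; m≤n⇒m≤1+n; +-comm; +-assoc; +-suc; +-monoʳ-<; +-monoˡ-≤; +-cancelˡ-≤; ≰⇒>)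
open import Data.Product using (_×_; _,_; proj₁; proj₂; ∃-syntax)
open import Data.Sum as Sum using (_⊎_; inj₁; inj₂; [_,_]′)
open import Data.Sum.Function.Propositional using (_⊎-↔_)
open import Data.Unit using (⊤; tt)
open import Function using (_∘_; id; flip; _on_; _↔_; mk↔ₛ′; Inverse)
open import Function.Construct.Composition using (_↔-∘_)
open import Function.Construct.Identity using (↔-id)
open import Function.Construct.Symmetry using (↔-sym)
open import Relation.Binary.Bundles using (DecPoset; DecTotalOrder)
open import Relation.Binary.Construct.Closure.ReflexiveTransitive using (Star; ε; _◅_; _◅◅_; gmap)
open import Relation.Binary.Core using (Rel)
open import Relation.Binary.Definitions using (DecidableEquality)
open import Relation.Binary.PropositionalEquality using (_≡_; refl; sym; trans; cong; cong₂; subst; subst₂)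
open import Relation.Nullary using (Dec; yes; no; ¬_; ¬?; contradiction; map′; _×-dec_; _⊎-dec_)
open import Relation.Unary using (Decidable)
import Data.Bool.Properties as Bool
import Data.Maybe.Properties as Maybe
import Data.Product.Properties as Product
import Text.Regex.Base
import Text.Regex.Properties

-- A run is brought into a form in which r holds at most one letter: since only
-- Sender writes, Receiver's steps can be advanced at will, except that Receiver
-- may then read letters of l that are not yet written. Such debts are recorded,
-- so that l becomes a signed channel. A configuration with debts x can replace
-- one with debts x′ whenever x is a subword of x′, and one with surplus y can be
-- turned into one with surplus y′ whenever y′ is a subword of y, by losing more
-- letters beforehand. Thus a pair of comparable debts, or of comparable surpluses
-- in the reverse order, allows a run to be shortened. Debts grow by one letter at
-- most per step, and so do surpluses when the run is read backwards; by Higman's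
-- lemma every sufficiently long run contains such a pair, with a computable
-- bound, and it remains to search among the short runs.

-- Almost-full relations

-- The obstacle is the tests, whose outcome may change when Receiver is advanced. An emptiness test
-- on r ties the agents together and becomes a joint move, past which nothing is advanced. A
-- non-emptiness test on r survives because one letter, not zero, is left on r. Receiver's tests on
-- l that run ahead of Sender are absorbed in the list of debts. Sender's non-emptiness test on l
-- may refer to a content that the advanced Receiver has consumed already; a Boolean flag remembers
-- that such a content existed. Debts and surpluses are compared in opposite directions. This is
-- harmless because they are never both non-empty: configurations fall into two classes, and a long
-- run visits one of them often. Both comparisons demand equal control, which ranges over a finite
-- set because r is capped. Well-quasi-orders enter as inductive almost-full relations, since
-- recursion on their derivations yields the bound as a number. The given regular languages are
-- absorbed in the control, so that only runs between empty channels have to be decided.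

data AF {X : Set} (R : Rel X 0ℓ) : Set₁ where
  now   : (∀ x y → R x y) → AF R
  later : (∀ x → AF (λ y z → R y z ⊎ R x y)) → AF R

af-mono : ∀ {X : Set} {R S : Rel X 0ℓ} → (∀ {x y} → R x y → S x y) → AF R → AF S
af-mono f (now r)   = now λ x y → f (r x y)
af-mono f (later r) = later λ x → af-mono (Sum.map f f) (r x)

af-on : ∀ {X Y : Set} (f : Y → X) {R : Rel X 0ℓ} → AF R → AF (R on f)
af-on f (now r)   = now λ x y → r (f x) (f y)
af-on f (later r) = later λ x → af-on f (r (f x))

-- Ramsey's theorem for almost-full relations, by raising the arity of the
-- exceptional predicates A and B from 0 to 2.

af-∪-nullary : ∀ {X : Set} {P Q R : Rel X 0ℓ} {A B : Set} → AF P → AF Q →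
               (∀ {x y} → P x y → R x y ⊎ A) → (∀ {x y} → Q x y → R x y ⊎ B) →
               AF (λ x y → R x y ⊎ A × B)
af-∪-nullary (now p) q f g =
  af-mono (λ {x} {y} q → [ inj₁ , (λ b → Sum.map₂ (_, b) (f (p x y))) ]′ (g q)) q
af-∪-nullary {R = R} (later p) q f g = later λ x →
  af-mono [ Sum.map inj₁ inj₁ , inj₁ ∘ inj₂ ]′
    (af-∪-nullary {R = λ y z → R y z ⊎ R x y} (p x) q
      [ Sum.map₁ inj₁ ∘ f , Sum.map₁ inj₂ ∘ f ]′ (Sum.map₁ inj₁ ∘ g))

-- Unfolding the first tree at `x` leaves the alternative `A x`, unfolding the second leaves `B x`.
-- Once `x` is fixed these no longer depend on the later elements, so the version of lower arity
-- merges the two recursive results.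
af-∪-unary : ∀ {X : Set} {P Q R : Rel X 0ℓ} {A B : X → Set} → AF P → AF Q →
             (∀ {x y} → P x y → R x y ⊎ A x) → (∀ {x y} → Q x y → R x y ⊎ B x) →
             AF (λ x y → R x y ⊎ A x × B x)
af-∪-unary (now p) q f g =
  af-mono (λ {x} {y} q → [ inj₁ , (λ b → Sum.map₂ (_, b) (f (p x y))) ]′ (g q)) q
af-∪-unary p@(later _) (now q) f g =
  af-mono (λ {x} {y} p → [ inj₁ , (λ a → Sum.map₂ (a ,_) (g (q x y))) ]′ (f p)) p
af-∪-unary {R = R} {A} {B} p@(later p′) q@(later q′) f g = later λ x →
  let C = λ y z → (R y z ⊎ A y × B y) ⊎ R x y in
  af-mono [ [ inj₁ , inj₂ ∘ inj₁ ]′ , inj₂ ∘ inj₂ ]′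
    (af-∪-nullary {R = C} {A x} {B x}
      (af-∪-unary {R = λ y z → (R y z ⊎ R x y) ⊎ A x} {A} {B} (p′ x) q
        [ Sum.map₁ (inj₁ ∘ inj₁) ∘ f , inj₁ ∘ Sum.map₁ inj₂ ∘ f ]′
        (Sum.map₁ (inj₁ ∘ inj₁) ∘ g))
      (af-∪-unary {R = λ y z → (R y z ⊎ R x y) ⊎ B x} {A} {B} p (q′ x)
        (Sum.map₁ (inj₁ ∘ inj₁) ∘ f)
        [ Sum.map₁ (inj₁ ∘ inj₁) ∘ g , inj₁ ∘ Sum.map₁ inj₂ ∘ g ]′)
      [ [ [ inj₁ ∘ inj₁ ∘ inj₁ , inj₁ ∘ inj₂ ]′ , inj₂ ]′ , inj₁ ∘ inj₁ ∘ inj₂ ]′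
      [ [ [ inj₁ ∘ inj₁ ∘ inj₁ , inj₁ ∘ inj₂ ]′ , inj₂ ]′ , inj₁ ∘ inj₁ ∘ inj₂ ]′)

af-∪-binary : ∀ {X : Set} {P Q R A B : Rel X 0ℓ} → AF P → AF Q →
              (∀ {x y} → P x y → R x y ⊎ A x y) → (∀ {x y} → Q x y → R x y ⊎ B x y) →
              AF (λ x y → R x y ⊎ A x y × B x y)
af-∪-binary (now p) q f g =
  af-mono (λ {x} {y} q → [ inj₁ , (λ b → Sum.map₂ (_, b) (f (p x y))) ]′ (g q)) q
af-∪-binary p@(later _) (now q) f g =
  af-mono (λ {x} {y} p → [ inj₁ , (λ a → Sum.map₂ (a ,_) (g (q x y))) ]′ (f p)) p
af-∪-binary {R = R} {A} {B} p@(later p′) q@(later q′) f g = later λ x →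
  let C = λ y z → (R y z ⊎ A y z × B y z) ⊎ R x y in
  af-mono [ [ inj₁ , inj₂ ∘ inj₁ ]′ , inj₂ ∘ inj₂ ]′
    (af-∪-unary {R = C} {A x} {B x}
      (af-∪-binary {R = λ y z → (R y z ⊎ R x y) ⊎ A x y} {A} {B} (p′ x) q
        [ Sum.map₁ (inj₁ ∘ inj₁) ∘ f , inj₁ ∘ Sum.map₁ inj₂ ∘ f ]′
        (Sum.map₁ (inj₁ ∘ inj₁) ∘ g))
      (af-∪-binary {R = λ y z → (R y z ⊎ R x y) ⊎ B x y} {A} {B} p (q′ x)
        (Sum.map₁ (inj₁ ∘ inj₁) ∘ f)
        [ Sum.map₁ (inj₁ ∘ inj₁) ∘ g , inj₁ ∘ Sum.map₁ inj₂ ∘ g ]′)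
      [ [ [ inj₁ ∘ inj₁ ∘ inj₁ , inj₁ ∘ inj₂ ]′ , inj₂ ]′ , inj₁ ∘ inj₁ ∘ inj₂ ]′
      [ [ [ inj₁ ∘ inj₁ ∘ inj₁ , inj₁ ∘ inj₂ ]′ , inj₂ ]′ , inj₁ ∘ inj₁ ∘ inj₂ ]′)

-- Ramsey's theorem with an empty common part `R`; a general `R` serves only to carry the induction.
af-∩ : ∀ {X : Set} {A B : Rel X 0ℓ} → AF A → AF B → AF (λ x y → A x y × B x y)
af-∩ a b = af-mono (λ { (inj₂ ab) → ab }) (af-∪-binary {R = λ _ _ → ⊥} a b inj₂ inj₂)

-- Higman's lemma: given w = a ∷ w′, a word is cut at its first a; what precedes
-- lies over a smaller alphabet, and what follows is treated by induction on w.

data Cut {k} (a : Fin (suc k)) : List (Fin (suc k)) → Set where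
  absent : ∀ u → Cut a (map (punchIn a) u)
  found  : ∀ u v → Cut a (map (punchIn a) u ++ a ∷ v)

cut : ∀ {k} (a : Fin (suc k)) w → Cut a w
cut a []      = absent []
cut a (b ∷ w) with a ≟ᶠ b
... | yes refl = found [] w
... | no a≢b with prepend a≢b (cut a w)
  where
  prepend : ∀ {w} (a≢b : a ≡ b → ⊥) → Cut a w → Cut a (punchIn a (punchOut a≢b) ∷ w)
  prepend a≢b (absent u)  = absent (punchOut a≢b ∷ u)
  prepend a≢b (found u v) = found (punchOut a≢b ∷ u) v
... | c rewrite punchIn-punchOut a≢b = c

before : ∀ {k} {a : Fin (suc k)} {w} → Cut a w → List (Fin k)
before (absent u)  = u
before (found u _) = u

after : ∀ {k} {a : Fin (suc k)} {w} → Cut a w → List (Fin (suc k))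
after (absent _)  = []
after (found _ v) = v

occurs : ∀ {k} {a : Fin (suc k)} {w} → Cut a w → Bool
occurs (absent _)  = false
occurs (found _ _) = true

af-Bool : AF {Bool} _≡_
af-Bool = later λ a → later λ b → now λ c _ → pigeonhole a b c
  where
  pigeonhole : ∀ a b c {d} → (c ≡ d ⊎ a ≡ c) ⊎ (b ≡ c ⊎ a ≡ b)
  pigeonhole false false _     = inj₂ (inj₂ refl)
  pigeonhole true  true  _     = inj₂ (inj₂ refl)
  pigeonhole false true  false = inj₁ (inj₂ refl)
  pigeonhole true  false true  = inj₁ (inj₂ refl)
  pigeonhole false true  true  = inj₂ (inj₁ refl)
  pigeonhole true  false false = inj₂ (inj₁ refl)

higman : ∀ k → AF (_⊆_ {A = Fin k})

-- This is the relation that `later` demands of subword embedding after a first word `w`, which is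
-- why `higman` is a single `later`. The letters before the cut use the smaller alphabet, those
-- after it the shorter `w`.
higman-avoiding : ∀ k (w : List (Fin k)) → AF (λ u v → u ⊆ v ⊎ w ⊆ u)
higman-avoiding k       []      = now λ u _ → inj₂ (minimum u)
higman-avoiding (suc k) (a ∷ w) =
  af-mono (λ {u} {v} (s , l , r) → recombine (cut a u) (cut a v) s l r)
    (af-∩ (af-on (λ u → occurs (cut a u)) af-Bool)
      (af-∩ (af-on (λ u → before (cut a u)) (higman k))
            (af-on (λ u → after (cut a u)) (higman-avoiding (suc k) w))))
  where
  recombine : ∀ {u v} (c : Cut a u) (d : Cut a v) → occurs c ≡ occurs d →
              before c ⊆ before d → after c ⊆ after d ⊎ w ⊆ after c →
              u ⊆ v ⊎ a ∷ w ⊆ u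
  recombine (absent _)  (absent _)  _ l _        = inj₁ (map⁺ (punchIn a) l)
  recombine (found _ _) (found _ _) _ l (inj₁ r) = inj₁ (++⁺ (map⁺ (punchIn a) l) (refl ∷ r))
  recombine (found u _) (found _ _) _ _ (inj₂ r) = inj₂ (++⁺ˡ (map (punchIn a) u) (refl ∷ r))

higman zero    = now λ { [] [] → [] }
higman (suc k) = later (higman-avoiding (suc k))

-- Equality of letters is embedding of one-letter words.
af-≡ : ∀ n → AF (_≡_ {A = Fin n})
af-≡ n = af-mono singleton (af-on (_∷ []) (higman n))
  where
  singleton : ∀ {x y : Fin n} → x ∷ [] ⊆ y ∷ [] → x ≡ y
  singleton (x≡y ∷ _) = x≡y

-- Cutting paths

words≤ : ∀ {t} → ℕ → List (List (Fin t))
words≤ zero    = [] ∷ []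
words≤ (suc k) = [] ∷ cartesianProductWith _∷_ (allFin _) (words≤ k)

∈-words≤ : ∀ {t k} (w : List (Fin t)) → length w ≤ k → w ∈ˡ words≤ k
∈-words≤ {k = zero}  []      _       = here refl
∈-words≤ {k = suc k} []      _       = here refl
∈-words≤ {k = suc k} (a ∷ w) (s≤s l) = there (∈-cartesianProductWith⁺ _∷_ (∈-allFin a) (∈-words≤ w l))

total : ∀ {A : Set} → (A → ℕ) → List A → ℕ
total f []       = 0
total f (x ∷ xs) = f x + total f xs

≤-total : ∀ {A : Set} (f : A → ℕ) {x xs} → x ∈ˡ xs → f x ≤ total f xs
≤-total f (here refl)       = m≤m+n _ _
≤-total f (there {x = y} i) = ≤-trans (≤-total f i) (m≤n+m _ (f y))

data Path {C : Set} (S : Rel C 0ℓ) : ℕ → C → C → Set where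
  []  : ∀ {c} → Path S 0 c c
  _∷_ : ∀ {n c d e} → S c d → Path S n d e → Path S (suc n) c e

module _ {C : Set} where

  infixr 5 _++ᵖ_

  _++ᵖ_ : ∀ {S : Rel C 0ℓ} {i j a b c} → Path S i a b → Path S j b c → Path S (i + j) a c
  []      ++ᵖ q = q
  (s ∷ p) ++ᵖ q = s ∷ (p ++ᵖ q)

  snoc : ∀ {S : Rel C 0ℓ} {n a b c} → Path S n a b → S b c → Path S (suc n) a c
  snoc []      s = s ∷ []
  snoc (t ∷ p) s = t ∷ snoc p s

  reverse : ∀ {S : Rel C 0ℓ} {n a b} → Path S n a b → Path (flip S) n b a
  reverse []      = []
  reverse (s ∷ p) = snoc (reverse p) s

  path-invariant : ∀ {S : Rel C 0ℓ} {I : C → Set} → (∀ {c d} → S c d → I c → I d) →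
                   ∀ {n c d} → Path S n c d → I c → I d
  path-invariant pres []      i = i
  path-invariant pres (s ∷ p) i = path-invariant pres p (pres s i)

  module _ {K : C → Set} (K? : Decidable K) where

    weight : C → ℕ
    weight c with K? c
    ... | yes _ = 1
    ... | no  _ = 0

    visits : ∀ {S : Rel C 0ℓ} {n a b} → Path S n a b → ℕ
    visits {a = a} []      = weight a
    visits {a = a} (_ ∷ p) = weight a + visits p

    visits-snoc : ∀ {S : Rel C 0ℓ} {n a b c} (p : Path S n a b) (s : S b c) →
                  visits (snoc p s) ≡ weight c + visits p
    visits-snoc {c = c} []      s = +-comm _ (weight c)
    visits-snoc {a = a} {c = c} (t ∷ p) s
      rewrite visits-snoc p s
            | sym (+-assoc (weight a) (weight c) (visits p))
            | +-comm (weight a) (weight c) = +-assoc (weight c) (weight a) (visits p)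

    visits-reverse : ∀ {S : Rel C 0ℓ} {n a b} (p : Path S n a b) → visits (reverse p) ≡ visits p
    visits-reverse []      = refl
    visits-reverse {a = a} (s ∷ p) =
      trans (visits-snoc (reverse p) s) (cong (weight a +_) (visits-reverse p))

  visits-complement : ∀ {K : C → Set} (K? : Decidable K) {S : Rel C 0ℓ} {n a b} (p : Path S n a b) →
                      n ≤ visits K? p + visits (¬? ∘ K?) p
  visits-complement K? []      = z≤n
  visits-complement K? {a = a} (s ∷ p) with K? a
  ... | yes _ = s≤s (visits-complement K? p)
  ... | no  _ = ≤-trans (s≤s (visits-complement K? p)) (≤-reflexive (sym (+-suc _ _)))

record Repetition {C : Set} (S : Rel C 0ℓ) (K : C → Set) (R : Rel C 0ℓ) (n : ℕ) (a b : C) : Set where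
  constructor repetition
  field
    {i j k} : ℕ
    {c d}   : C
    prefix  : Path S i a c
    loop    : Path S (suc j) c d
    suffix  : Path S k d b
    from-K  : K c
    to-K    : K d
    related : R c d
    length≡ : i + (suc j + k) ≡ n

module _ {C : Set} {S : Rel C 0ℓ} {K : C → Set} where

  extend : ∀ {R : Rel C 0ℓ} {n a b c} → S a b → Repetition S K R n b c → Repetition S K R (suc n) a c
  extend s (repetition p l q k k′ r e) = repetition (s ∷ p) l q k k′ r (cong suc e)

  from-first : ∀ {R : Rel C 0ℓ} {n a b c} → K a → S a b →
               ∀ {i j d} → Path S i b d → Path S j d c → K d → R a d → i + j ≡ n →
               Repetition S K R (suc n) a c
  from-first k s p q k′ r e = repetition [] (s ∷ p) q k k′ r (cong suc e)

  -- The second alternative relates the head `a` to the point `c` where the loop of the tail begins.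
  -- The new loop then runs from `a` to `c`, and the old loop joins the suffix.
  unfold-first : ∀ {R : Rel C 0ℓ} {n a b c} → K a → S a b →
                 Repetition S K (λ x y → R x y ⊎ R a x) n b c → Repetition S K R (suc n) a c
  unfold-first k s (repetition p l q k₁ k₂ (inj₁ r) e) = repetition (s ∷ p) l q k₁ k₂ r (cong suc e)
  unfold-first k s (repetition p l q k₁ k₂ (inj₂ r) e) = from-first k s p (l ++ᵖ q) k₁ r e

  visit : (K? : Decidable K) → ∀ {n a b} (p : Path S n a b) → 1 ≤ visits K? p →
          ∃[ i ] ∃[ j ] ∃[ c ] Path S i a c × Path S j c b × K c × i + j ≡ n
  visit K? {a = a} p l with K? a
  visit K? {a = a} p       l | yes k = _ , _ , _ , [] , p , k , refl
  visit K? {a = a} []      l | no ¬k with K? a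
  visit K? {a = a} []      () | no ¬k | no _
  visit K? {a = a} []      l | no ¬k | yes k = contradiction k ¬k
  visit K? {a = a} (s ∷ p) l | no ¬k with K? a
  ... | yes k = contradiction k ¬k
  ... | no _  =
    let i , j , c , p₁ , p₂ , k , e = visit K? p l in suc i , j , c , s ∷ p₁ , p₂ , k , cong suc e

  module _ (K? : Decidable K) {n t : ℕ} (code : C → Fin n × List (Fin t)) (size : C → ℕ)
           (code-size : ∀ {c} → K c → length (proj₂ (code c)) ≤ suc (size c))
           (grow-K : ∀ {c d} → S c d → K c → size d ≤ suc (size c))
           (grow-¬K : ∀ {c d} → S c d → ¬ K c → size d ≤ size c) where

    codes : ℕ → List (Fin n × List (Fin t))
    codes k = cartesianProduct (allFin n) (words≤ (suc k))

    ∈-codes : ∀ {c k} → K c → size c ≤ k → code c ∈ˡ codes k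
    ∈-codes kc l =
      ∈-cartesianProduct⁺ (∈-allFin _) (∈-words≤ _ (≤-trans (code-size kc) (s≤s l)))

    -- Induction on the almost-full tree. The code at the first visit to `K` selects a subtree; as
    -- the size is at most `k` there, only finitely many codes are possible. Steps outside `K` must
    -- not increase the size at all, because their number is not bounded by the visits.
    repetition-bound : ∀ {R : Rel (Fin n × List (Fin t)) 0ℓ} → AF R → ∀ k → ∃[ B ]
      (∀ {n a b} (p : Path S n a b) → size a ≤ k → B ≤ visits K? p → Repetition S K (R on code) n a b)
    repetition-bound {R} (now r) k = 2 , go
      where
      go : ∀ {n a b} (p : Path S n a b) → size a ≤ k → 2 ≤ visits K? p → Repetition S K (R on code) n a b
      go {a = a} []      _ l with K? a
      go         []      _ (s≤s ()) | yes _
      go         []      _ () | no _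
      go {a = a} (s ∷ p) z l with K? a
      ... | no ¬k = extend s (go p (≤-trans (grow-¬K s ¬k) z) l)
      ... | yes ka =
        let _ , _ , _ , p₁ , p₂ , kc , e = visit K? p (s≤s⁻¹ l) in from-first ka s p₁ p₂ kc (r _ _) e
    -- The sum dominates the bound of every subtree that the first code can select. Of the two extra
    -- visits one is the first visit itself; the other makes the empty path impossible.
    repetition-bound {R} (later r) k = suc (suc (total B (codes k))) , go
      where
      B : Fin n × List (Fin t) → ℕ
      B w = proj₁ (repetition-bound (r w) (suc k))
      go : ∀ {n a b} (p : Path S n a b) → size a ≤ k → suc (suc (total B (codes k))) ≤ visits K? p →
           Repetition S K (R on code) n a b
      go {a = a} []      _ l with K? a
      go         []      _ (s≤s ()) | yes _
      go         []      _ () | no _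
      go {a = a} (s ∷ p) z l with K? a
      ... | no ¬k = extend s (go p (≤-trans (grow-¬K s ¬k) z) l)
      ... | yes k = unfold-first k s
        (proj₂ (repetition-bound (r (code a)) _) p (≤-trans (grow-K s k) (s≤s z))
          (≤-trans (≤-trans (≤-total B (∈-codes k z)) (n≤1+n _)) (s≤s⁻¹ l)))

_⊑_ : ∀ {n t} → Rel (Fin n × List (Fin t)) 0ℓ
(s , w) ⊑ (s′ , w′) = s ≡ s′ × w ⊆ w′

af-⊑ : ∀ {n t} → AF (_⊑_ {n} {t})
af-⊑ {n} {t} = af-∩ (af-on proj₁ (af-≡ n)) (af-on proj₂ (higman t))

-- Of two K-configurations the earlier one may take over the continuation of the
-- later one, and of two ¬K-configurations the later one the history of the
-- earlier one. Hence the codes are compared forwards on K and backwards on ¬K.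
record Cuttable {C : Set} (S : Rel C 0ℓ) (start end : C) : Set₁ where
  field
    {K}           : C → Set
    K?            : Decidable K
    {n t n′ t′}   : ℕ
    code          : C → Fin n × List (Fin t)
    size          : C → ℕ
    code-size     : ∀ {c} → K c → length (proj₂ (code c)) ≤ suc (size c)
    grow-K        : ∀ {c d} → S c d → K c → size d ≤ suc (size c)
    grow-¬K       : ∀ {c d} → S c d → ¬ K c → size d ≤ size c
    size-start    : size start ≡ 0
    code′         : C → Fin n′ × List (Fin t′)
    size′         : C → ℕ
    code-size′    : ∀ {c} → ¬ K c → length (proj₂ (code′ c)) ≤ suc (size′ c)
    shrink-¬K     : ∀ {c d} → S c d → ¬ K d → size′ c ≤ suc (size′ d)
    shrink-K      : ∀ {c d} → S c d → K d → size′ c ≤ size′ d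
    size′-end     : size′ end ≡ 0
    continue      : ∀ {i j k c d} → K c → K d → code c ⊑ code d →
                    Path S i start c → Path S j start d → Path S k d end → Path S k c end
    precede       : ∀ {i j c d} → ¬ K c → ¬ K d → code′ d ⊑ code′ c →
                    Path S i start c → Path S j start d → Path S i start d

module _ {C : Set} {S : Rel C 0ℓ} {start end : C} (cuttable : Cuttable S start end) where
  open Cuttable cuttable

  shorten : ∃[ B ] (∀ {n} → Path S n start end → B ≤ n → ∃[ n′ ] n′ < n × Path S n′ start end)
  shorten = B₁ + B₂ , short
    where
    forwards = repetition-bound {S = S} K? code size code-size grow-K grow-¬K af-⊑ 0
    backwards = repetition-bound {S = flip S} (¬? ∘ K?) code′ size′ code-size′
      (λ s ¬k → shrink-¬K s ¬k) (λ {_} {d} s ¬¬k → shrink-K s (stable ¬¬k)) af-⊑ 0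
      where
      stable : ∀ {c} → ¬ ¬ K c → K c
      stable {c} ¬¬k with K? c
      ... | yes k = k
      ... | no ¬k = contradiction ¬k ¬¬k
    B₁ = proj₁ forwards
    B₂ = proj₁ backwards

    cut-forwards : ∀ {n} → Repetition S K (_⊑_ on code) n start end →
                   ∃[ n′ ] n′ < n × Path S n′ start end
    cut-forwards (repetition {i} {j} {k} p l q kc kd r refl) =
      i + k , +-monoʳ-< i (s≤s (m≤n+m k j)) , p ++ᵖ continue kc kd r p (p ++ᵖ l) q

    cut-backwards : ∀ {n} → Repetition (flip S) (¬_ ∘ K) (_⊑_ on code′) n end start →
                    ∃[ n′ ] n′ < n × Path S n′ start end
    cut-backwards (repetition {i} {j} {k} p l q kc kd r refl) =
      k + i , ≤-<-trans (≤-reflexive (+-comm k i)) (+-monoʳ-< i (s≤s (m≤n+m k j))) ,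
      -- What is met first backwards is later in time: the later configuration is reached here by
      -- the history of the earlier one, of length `k`.
      precede kd kc r (reverse q) (reverse q ++ᵖ reverse l) ++ᵖ reverse p

    short : ∀ {n} → Path S n start end → B₁ + B₂ ≤ n → ∃[ n′ ] n′ < n × Path S n′ start end
    short p l with B₁ ≤? visits K? p
    ... | yes v = cut-forwards (proj₂ forwards p (≤-reflexive size-start) v)
    ... | no ¬v = cut-backwards (proj₂ backwards (reverse p) (≤-reflexive size′-end)
                    (≤-trans B₂≤ (≤-reflexive (sym (visits-reverse (¬? ∘ K?) p)))))
      where
      B₂≤ : B₂ ≤ visits (¬? ∘ K?) p
      B₂≤ = +-cancelˡ-≤ B₁ _ _ (≤-trans l (≤-trans (visits-complement K? p)
              (+-monoˡ-≤ _ (≤-trans (n≤1+n _) (≰⇒> ¬v)))))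

  module _ (_≟_ : DecidableEquality C)
           (successor? : ∀ c {G : C → Set} → (∀ d → Dec (G d)) → Dec (∃[ d ] S c d × G d)) where

    path? : ∀ n c → Dec (Path S n c end)
    path? zero    c = map′ (λ { refl → [] }) (λ { [] → refl }) (c ≟ end)
    path? (suc n) c = map′ (λ (_ , s , p) → s ∷ p) (λ { (s ∷ p) → _ , s , p })
                        (successor? c (path? n))

    shorter-path? : ∀ B → Dec (∃[ n ] n < B × Path S n start end)
    shorter-path? zero    = no λ { (_ , () , _) }
    shorter-path? (suc B) with path? B start | shorter-path? B
    ... | yes p | _               = yes (B , ≤-refl , p)
    ... | no _  | yes (n , l , p) = yes (n , m≤n⇒m≤1+n l , p)
    ... | no ¬p | no ¬q           = no λ { (n , l , p) → none n l p }
      where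
      none : ∀ n → n < suc B → Path S n start end → ⊥
      none n l p with suc n ≤? B
      ... | yes n<B = ¬q (n , n<B , p)
      ... | no n≮B with ≤-antisym (s≤s⁻¹ l) (s≤s⁻¹ (≰⇒> n≮B))
      ...   | refl = ¬p p

    reachable? : Dec (∃[ n ] Path S n start end)
    reachable? = map′ (λ (n , _ , p) → n , p) (λ (n , p) → shrink n (<-wellFounded n) p)
                   (shorter-path? B)
      where
      B = proj₁ shorten
      shrink : ∀ n → Acc _<_ n → Path S n start end → ∃[ n′ ] n′ < B × Path S n′ start end
      shrink n (acc rec) p with B ≤? n
      ... | yes B≤n = let n′ , n′<n , p′ = proj₂ shorten p B≤n in shrink n′ (rec n′<n) p′
      ... | no B≰n  = n , ≰⇒> B≰n , p

-- Two-agent systems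

data Op (m : ℕ) : Set where
  idle nonemptyʳ emptyˡ nonemptyˡ : Op m
  onʳ onˡ : Fin m → Op m

record Finite (A : Set) : Set where
  field
    {size}   : ℕ
    indexing : A ↔ Fin size
  open Inverse indexing public using (to; from)

  to-injective : ∀ {a b} → to a ≡ to b → a ≡ b
  to-injective e = trans (sym (Inverse.strictlyInverseʳ indexing _))
                         (trans (cong from e) (Inverse.strictlyInverseʳ indexing _))

  _≟_ : DecidableEquality A
  a ≟ b = map′ to-injective (cong to) (to a ≟ᶠ to b)

  exists? : ∀ {G : A → Set} → (∀ a → Dec (G a)) → Dec (∃[ a ] G a)
  exists? {G} G? = map′ (λ (i , g) → from i , g)
    (λ (a , g) → to a , subst G (sym (Inverse.strictlyInverseʳ indexing a)) g)
    (any? (G? ∘ from))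

finite-⊎ : ∀ {A B : Set} → Finite A → Finite B → Finite (A ⊎ B)
finite-⊎ a b = record { indexing = ↔-sym +↔⊎ ↔-∘ (Finite.indexing a ⊎-↔ Finite.indexing b) }

finite-⊥ : Finite ⊥
finite-⊥ = record { indexing = ↔-sym 0↔⊥ }

finite-⊤ : Finite ⊤
finite-⊤ = record { indexing = ↔-sym 1↔⊤ }

finite-Fin : ∀ {n} → Finite (Fin n)
finite-Fin = record { indexing = ↔-id _ }

finite-op : ∀ {m} → Finite (Op m)
finite-op {m} = record { indexing = Finite.indexing (finite-⊎ (finite-Fin {4}) (finite-⊎ finite-Fin finite-Fin))
                                    ↔-∘ mk↔ₛ′ code decode code-decode decode-code }
  where
  code : Op m → Fin 4 ⊎ Fin m ⊎ Fin m
  code idle      = inj₁ (# 0)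
  code nonemptyʳ = inj₁ (# 1)
  code emptyˡ    = inj₁ (# 2)
  code nonemptyˡ = inj₁ (# 3)
  code (onʳ a)   = inj₂ (inj₁ a)
  code (onˡ a)   = inj₂ (inj₂ a)

  decode : Fin 4 ⊎ Fin m ⊎ Fin m → Op m
  decode (inj₁ zero)                   = idle
  decode (inj₁ (suc zero))             = nonemptyʳ
  decode (inj₁ (suc (suc zero)))       = emptyˡ
  decode (inj₁ (suc (suc (suc zero)))) = nonemptyˡ
  decode (inj₂ (inj₁ a))               = onʳ a
  decode (inj₂ (inj₂ a))               = onˡ a

  code-decode : ∀ i → code (decode i) ≡ i
  code-decode (inj₁ zero)                   = refl
  code-decode (inj₁ (suc zero))             = refl
  code-decode (inj₁ (suc (suc zero)))       = refl
  code-decode (inj₁ (suc (suc (suc zero)))) = refl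
  code-decode (inj₂ (inj₁ _))               = refl
  code-decode (inj₂ (inj₂ _))               = refl

  decode-code : ∀ o → decode (code o) ≡ o
  decode-code idle      = refl
  decode-code nonemptyʳ = refl
  decode-code emptyˡ    = refl
  decode-code nonemptyˡ = refl
  decode-code (onʳ _)   = refl
  decode-code (onˡ _)   = refl

-- Emptiness tests on r are replaced by joint moves of the agents with r empty:
-- such a move forces Receiver to have caught up with Sender, and both states
-- may be constrained.
record System : Set₁ where
  field
    m         : ℕ
    P Q       : Set
    P-finite  : Finite P
    Q-finite  : Finite Q
    SRule     : P → Op m → P → Set
    RRule     : Q → Op m → Q → Set
    Sync      : P → Q → P → Q → Set
    SRule?    : ∀ p o p′ → Dec (SRule p o p′)
    RRule?    : ∀ q o q′ → Dec (RRule q o q′)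
    Sync?     : ∀ p q p′ q′ → Dec (Sync p q p′ q′)

data Send {m} : Op m → Rel (Contents m) 0ℓ where
  idle      : ∀ {k} → Send idle k k
  writeʳ    : ∀ {a u v} → Send (onʳ a) (u , v) (u ++ a ∷ [] , v)
  writeˡ    : ∀ {a u v} → Send (onˡ a) (u , v) (u , v ++ a ∷ [])
  nonemptyʳ : ∀ {a u v} → Send nonemptyʳ (a ∷ u , v) (a ∷ u , v)
  emptyˡ    : ∀ {u} → Send emptyˡ (u , []) (u , [])
  nonemptyˡ : ∀ {a u v} → Send nonemptyˡ (u , a ∷ v) (u , a ∷ v)

data Receive {m} : Op m → Rel (Contents m) 0ℓ where
  idle      : ∀ {k} → Receive idle k k
  readʳ     : ∀ {a u v} → Receive (onʳ a) (a ∷ u , v) (u , v)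
  readˡ     : ∀ {a u v} → Receive (onˡ a) (u , a ∷ v) (u , v)
  nonemptyʳ : ∀ {a u v} → Receive nonemptyʳ (a ∷ u , v) (a ∷ u , v)
  emptyˡ    : ∀ {u} → Receive emptyˡ (u , []) (u , [])
  nonemptyˡ : ∀ {a u v} → Receive nonemptyˡ (u , a ∷ v) (u , a ∷ v)

-- In the signed semantics Receiver may read from l ahead of Sender: the content
-- of l becomes a list x of debts, to be paid by later writes, together with a
-- list y of surplus letters, one of the two being empty. The debt suc a is a
-- read of a and the debt zero a non-emptiness test. A letter is lost when it is
-- written, or else when a non-emptiness test has profited from it.

data Write {m} (a : Fin m) : (x : List (Fin (suc m))) (y : Word m) →
                             List (Fin (suc m)) → Word m → Set where
  lose : ∀ {x y} → Write a x y x y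
  app  : ∀ {y y′} → y′ ≡ y ++ a ∷ [] → Write a [] y [] y′
  pay  : ∀ {x y} → Write a (suc a ∷ x) y x y
  pass : ∀ {x y x′ y′} → Write a x y x′ y′ → Write a (zero ∷ x) y x′ y′

-- If an emptiness test follows the last debt, then the letter paying that debt
-- is gone by then, so that a pending non-emptiness test amounts to a read.
data Commit {m} : Rel (List (Fin (suc m))) 0ℓ where
  none  : Commit [] []
  letter : ∀ {a} → Commit (suc a ∷ []) (suc a ∷ [])
  guess : ∀ {a} → Commit (zero ∷ []) (suc a ∷ [])
  skip  : ∀ {s t x x′} → Commit (t ∷ x) x′ → Commit (s ∷ t ∷ x) (s ∷ x′)

data Borrow {m} : Op m → (x : List (Fin (suc m))) (y : Word m) →
                  List (Fin (suc m)) → Word m → Set where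
  idle : ∀ {x y} → Borrow idle x y x y
  read : ∀ {a x y} → Borrow (onˡ a) x (a ∷ y) x y
  owe  : ∀ {a x} → Borrow (onˡ a) x [] (x ++ suc a ∷ []) []
  empty : ∀ {x x′} → Commit x x′ → Borrow emptyˡ x [] x′ []
  keep : ∀ {a x y} → Borrow nonemptyˡ x (a ∷ y) x (a ∷ y)
  drop : ∀ {a x y} → Borrow nonemptyˡ x (a ∷ y) x y
  pend : ∀ {x} → Borrow nonemptyˡ x [] (x ++ zero ∷ []) []

-- Commuting Receiver's actions on l before Sender's writes

borrow-∷ : ∀ {m} {o : Op m} {x y x′ y′ t} → Borrow o x y x′ y′ →
           Borrow o (t ∷ x) y (t ∷ x′) y′ ⊎ (o ≡ emptyˡ × x ≡ [] × y ≡ [] × x′ ≡ [] × y′ ≡ [])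
borrow-∷ idle = inj₁ idle
borrow-∷ read = inj₁ read
borrow-∷ owe  = inj₁ owe
borrow-∷ keep = inj₁ keep
borrow-∷ drop = inj₁ drop
borrow-∷ pend = inj₁ pend
-- Behind the debt `t` this emptiness test would have to commit `t` itself, so it does not carry
-- over.
borrow-∷ (empty none)     = inj₂ (refl , refl , refl , refl , refl)
borrow-∷ (empty letter)   = inj₁ (empty (skip letter))
borrow-∷ (empty guess)    = inj₁ (empty (skip guess))
borrow-∷ (empty (skip c)) = inj₁ (empty (skip (skip c)))

-- If Receiver uses the very letter just written, the exchange creates a debt: a read becomes `owe`
-- followed by `pay`, a non-emptiness test becomes `pend` followed by `pass`. An emptiness test
-- cannot follow `app`, which leaves a surplus.
write-borrow : ∀ {m} {a : Fin m} {o x y x₁ y₁ x₂ y₂} → Write a x y x₁ y₁ → Borrow o x₁ y₁ x₂ y₂ →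
               ∃[ x′ ] ∃[ y′ ] Borrow o x y x′ y′ × Write a x′ y′ x₂ y₂
write-borrow lose b = _ , _ , b , lose
write-borrow (app e) idle = _ , _ , idle , app e
write-borrow {y = []}    (app refl) read = _ , _ , owe , pay
write-borrow {y = _ ∷ _} (app refl) read = _ , _ , read , app refl
write-borrow {y = []}    (app ()) owe
write-borrow {y = _ ∷ _} (app ()) owe
write-borrow {y = []}    (app ()) (empty _)
write-borrow {y = _ ∷ _} (app ()) (empty _)
write-borrow {y = []}    (app refl) keep = _ , _ , pend , pass (app refl)
write-borrow {y = _ ∷ _} (app refl) keep = _ , _ , keep , app refl
write-borrow {y = []}    (app refl) drop = _ , _ , pend , pass lose
write-borrow {y = _ ∷ _} (app refl) drop = _ , _ , drop , app refl
write-borrow {y = []}    (app ()) pend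
write-borrow {y = _ ∷ _} (app ()) pend
write-borrow pay b with borrow-∷ b
... | inj₁ b′ = _ , _ , b′ , pay
... | inj₂ (refl , refl , refl , refl , refl) = _ , _ , empty letter , pay
write-borrow (pass w) b with write-borrow w b
... | _ , _ , b′ , w′ with borrow-∷ b′
...   | inj₁ b″ = _ , _ , b″ , pass w′
...   | inj₂ (refl , refl , refl , refl , refl) = pass-empty b w′
  where
  pass-empty : ∀ {m} {a : Fin m} {x₁ y₁ x₂ y₂} → Borrow emptyˡ x₁ y₁ x₂ y₂ → Write a [] [] x₂ y₂ →
               ∃[ x′ ] ∃[ y′ ] Borrow emptyˡ (zero ∷ []) [] x′ y′ × Write a x′ y′ x₂ y₂
  -- The letter passed the pending test and was lost before the emptiness test. With the emptiness
  -- test moved forward, the pending debt is guessed to be this letter, which then pays it.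
  pass-empty (empty _) lose = _ , _ , empty guess , pay
  pass-empty (empty _) (app ())

-- Simulation by fewer debts and by smaller surpluses

write-mono : ∀ {m} {a : Fin m} {x y x′ y′ x₀} → Write a x y x′ y′ → x₀ ⊆ x →
             ∃[ x₀′ ] x₀′ ⊆ x′ × Write a x₀ y x₀′ y′
write-mono lose i = _ , i , lose
write-mono (app e) [] = _ , [] , app e
-- The debt that this letter would pay is absent, so the letter is lost.
write-mono pay (_ ∷ʳ i) = _ , i , lose
write-mono pay (refl ∷ i) = _ , i , pay
write-mono (pass w) (_ ∷ʳ i) = write-mono w i
write-mono (pass w) (refl ∷ i) = let _ , j , w′ = write-mono w i in _ , j , pass w′

-- Needed when the smaller list of debts ends in a test that is not last in the larger one: the test
-- has to be committed to a letter, and one that the larger list owes later keeps the result a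
-- subword.
commit-letter : ∀ {m x x′} {t : Fin (suc m)} → Commit (t ∷ x) x′ → ∃[ a ] suc a ∷ [] ⊆ x′
commit-letter letter   = _ , refl ∷ []
commit-letter guess    = _ , refl ∷ []
commit-letter (skip c) = let a , i = commit-letter c in a , _ ∷ʳ i

commit-mono : ∀ {m} {x x′ x₀ : List (Fin (suc m))} → Commit x x′ → x₀ ⊆ x →
              ∃[ x₀′ ] x₀′ ⊆ x′ × Commit x₀ x₀′
commit-mono none [] = _ , [] , none
commit-mono letter (_ ∷ʳ []) = _ , minimum _ , none
commit-mono letter (refl ∷ []) = _ , ⊆-refl , letter
commit-mono guess (_ ∷ʳ []) = _ , minimum _ , none
commit-mono guess (refl ∷ []) = _ , ⊆-refl , guess
commit-mono (skip c) (_ ∷ʳ i) = let _ , j , c′ = commit-mono c i in _ , _ ∷ʳ j , c′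
commit-mono (skip {zero} c) (_∷_ {xs = []} refl i) = let a , j = commit-letter c in _ , zero ∷ʳ j , guess
commit-mono (skip {suc a} c) (_∷_ {xs = []} refl i) = _ , refl ∷ minimum _ , letter
commit-mono (skip c) (_∷_ {xs = _ ∷ _} refl i) =
  let _ , j , c′ = commit-mono c i in _ , refl ∷ j , skip c′

borrow-mono : ∀ {m} {o : Op m} {x y x′ y′ x₀} → Borrow o x y x′ y′ → x₀ ⊆ x →
              ∃[ x₀′ ] x₀′ ⊆ x′ × Borrow o x₀ y x₀′ y′
borrow-mono idle i = _ , i , idle
borrow-mono read i = _ , i , read
borrow-mono owe i = _ , ++⁺ i ⊆-refl , owe
borrow-mono (empty c) i = let _ , j , c′ = commit-mono c i in _ , j , empty c′
borrow-mono keep i = _ , i , keep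
borrow-mono drop i = _ , i , drop
borrow-mono pend i = _ , ++⁺ i ⊆-refl , pend

⊆-snoc⁻ : ∀ {A : Set} {a : A} {d} y → d ⊆ y ++ a ∷ [] → d ⊆ y ⊎ ∃[ d′ ] d ≡ d′ ++ a ∷ [] × d′ ⊆ y
⊆-snoc⁻ []      (_ ∷ʳ [])   = inj₁ []
⊆-snoc⁻ []      (refl ∷ []) = inj₂ ([] , refl , [])
⊆-snoc⁻ (b ∷ y) (.b ∷ʳ i) with ⊆-snoc⁻ y i
... | inj₁ j = inj₁ (b ∷ʳ j)
... | inj₂ (d , e , j) = inj₂ (d , e , b ∷ʳ j)
⊆-snoc⁻ (b ∷ y) (refl ∷ i) with ⊆-snoc⁻ y i
... | inj₁ j = inj₁ (refl ∷ j)
... | inj₂ (d , e , j) = inj₂ (b ∷ d , cong (b ∷_) e , refl ∷ j)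

-- A smaller surplus is obtained by losing more letters.
write-back : ∀ {m} {a : Fin m} {x y x′ y′ d′} → Write a x y x′ y′ → d′ ⊆ y′ →
             ∃[ d ] d ⊆ y × Write a x d x′ d′
write-back lose i = _ , i , lose
write-back {y = y} (app refl) i with ⊆-snoc⁻ y i
... | inj₁ j = _ , j , lose
... | inj₂ (d , e , j) = d , j , app e
write-back pay i = _ , i , pay
write-back (pass w) i = let d , j , w′ = write-back w i in d , j , pass w′

borrow-back : ∀ {m} {o : Op m} {x y x′ y′ d′} → Borrow o x y x′ y′ → d′ ⊆ y′ →
              ∃[ d ] d ⊆ y × Borrow o x d x′ d′
borrow-back idle i = _ , i , idle
borrow-back read i = _ , refl ∷ i , read
borrow-back owe [] = _ , [] , owe
borrow-back (empty c) [] = _ , [] , empty c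
-- The tested letter is not to remain, yet the test needs it: this is what `drop` is for.
borrow-back {d′ = []}    keep i = _ , refl ∷ minimum _ , drop
borrow-back {d′ = _ ∷ _} keep i = _ , i , keep
borrow-back drop i = _ , refl ∷ i , drop
borrow-back pend [] = _ , [] , pend

-- The channel semantics and the signed semantics

module Semantics′ (S : System) where
  open System S

  Config : Set
  Config = P × Q × Contents m

  data LocalStep : Rel (Q × Contents m) 0ℓ where
    receive : ∀ {q o q′ k k′} → RRule q o q′ → Receive o k k′ → LocalStep (q , k) (q′ , k′)
    lose    : ∀ {q u v v′} → v′ ⊆ v → LocalStep (q , u , v) (q , u , v′)

  data ChannelStep : Rel Config 0ℓ where
    send  : ∀ {p o p′ q k k′} → SRule p o p′ → Send o k k′ → ChannelStep (p , q , k) (p′ , q , k′)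
    local : ∀ {p l l′} → LocalStep l l′ → ChannelStep (p , l) (p , l′)
    sync  : ∀ {p q p′ q′ v} → Sync p q p′ q′ → ChannelStep (p , q , [] , v) (p′ , q′ , [] , v)

  Debts : Set
  Debts = List (Fin (suc m))

  -- The flag of a signed configuration tells whether Receiver can be delayed so
  -- far that l is non-empty.
  SignedConfig : Set
  SignedConfig = P × Bool × Q × Word m × Debts × Word m

  -- A write sets the flag even if the letter is lost or pays a debt, since l is non-empty right
  -- after the write and before Receiver moves on. An emptiness test clears it: from an empty l no
  -- delay of Receiver yields a letter until Sender writes again. The non-emptiness test consults
  -- the flag alone, so Receiver's steps cannot disable it.
  data SignedSend : Op m → Rel (Bool × Word m × Debts × Word m) 0ℓ where
    idle      : ∀ {c} → SignedSend idle c c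
    write     : ∀ {a b ρ x y x′ y′} → Write a x y x′ y′ →
                SignedSend (onˡ a) (b , ρ , x , y) (true , ρ , x′ , y′)
    nonemptyʳ : ∀ {a b ρ x y} → SignedSend nonemptyʳ (b , a ∷ ρ , x , y) (b , a ∷ ρ , x , y)
    emptyˡ    : ∀ {b ρ x} → SignedSend emptyˡ (b , ρ , x , []) (false , ρ , x , [])
    nonemptyˡ : ∀ {ρ x y} → SignedSend nonemptyˡ (true , ρ , x , y) (true , ρ , x , y)

  data SignedReceive : Op m → Rel (Word m × Debts × Word m) 0ℓ where
    borrow    : ∀ {o ρ x y x′ y′} → Borrow o x y x′ y′ → SignedReceive o (ρ , x , y) (ρ , x′ , y′)
    readʳ     : ∀ {a ρ x y} → SignedReceive (onʳ a) (a ∷ ρ , x , y) (ρ , x , y)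
    nonemptyʳ : ∀ {a ρ x y} → SignedReceive nonemptyʳ (a ∷ ρ , x , y) (a ∷ ρ , x , y)

  -- A joint move fixes Receiver's position and so cancels earlier delays; the flag can hold
  -- afterwards only if there is a surplus at that moment. In `drop` the first letter serves to set
  -- the flag and is then lost, so that a smaller surplus can follow.
  data Settle : Word m → Bool → Word m → Set where
    clear : ∀ {y} → Settle y false y
    keep  : ∀ {a y} → Settle (a ∷ y) true (a ∷ y)
    drop  : ∀ {a y} → Settle (a ∷ y) true y

  data SignedStep : Rel SignedConfig 0ℓ where
    transmit : ∀ {p a p′ b q ρ x y} → SRule p (onʳ a) p′ →
               SignedStep (p , b , q , ρ , x , y) (p′ , b , q , ρ ++ a ∷ [] , x , y)
    send     : ∀ {p o p′ b q k b′ k′} → SRule p o p′ → SignedSend o (b , k) (b′ , k′) →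
               SignedStep (p , b , q , k) (p′ , b′ , q , k′)
    receive  : ∀ {p b q o q′ k k′} → RRule q o q′ → SignedReceive o k k′ →
               SignedStep (p , b , q , k) (p , b , q′ , k′)
    sync     : ∀ {p b q y p′ b′ q′ y′} → Sync p q p′ q′ → Settle y b′ y′ →
               SignedStep (p , b , q , [] , [] , y) (p′ , b′ , q′ , [] , [] , y′)

  ρ-of : SignedConfig → Word m
  ρ-of (_ , _ , _ , ρ , _ , _) = ρ

  CappedStep : Rel SignedConfig 0ℓ
  CappedStep c d = SignedStep c d × length (ρ-of d) ≤ 1

  Balanced : Debts → Word m → Set
  Balanced x y = x ≡ [] ⊎ y ≡ []

  write-balanced : ∀ {a x y x′ y′} → Write a x y x′ y′ → Balanced x y → Balanced x′ y′
  write-balanced lose     i           = i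
  write-balanced (app _)  _           = inj₁ refl
  write-balanced pay      (inj₂ refl) = inj₂ refl
  write-balanced (pass w) (inj₂ refl) = write-balanced w (inj₂ refl)

  borrow-balanced : ∀ {o x y x′ y′} → Borrow o x y x′ y′ → Balanced x y → Balanced x′ y′
  borrow-balanced idle      i           = i
  borrow-balanced read      (inj₁ refl) = inj₁ refl
  borrow-balanced owe       _           = inj₂ refl
  borrow-balanced (empty _) _           = inj₂ refl
  borrow-balanced keep      i           = i
  borrow-balanced drop      (inj₁ refl) = inj₁ refl
  borrow-balanced pend      _           = inj₂ refl

  balanced : SignedConfig → Set
  balanced (_ , _ , _ , _ , x , y) = Balanced x y

  step-balanced : ∀ {c d} → SignedStep c d → balanced c → balanced d
  step-balanced (transmit _)           i = i
  step-balanced (send _ idle)          i = i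
  step-balanced (send _ (write w))     i = write-balanced w i
  step-balanced (send _ nonemptyʳ)     i = i
  step-balanced (send _ emptyˡ)        i = i
  step-balanced (send _ nonemptyˡ)     i = i
  step-balanced (receive _ (borrow b)) i = borrow-balanced b i
  step-balanced (receive _ readʳ)      i = i
  step-balanced (receive _ nonemptyʳ)  i = i
  step-balanced (sync _ _)             _ = inj₁ refl

  -- From signed runs to runs

  LocalRun : Rel (Q × Contents m) 0ℓ
  LocalRun = Star LocalStep

  -- Receiver's local steps contain no emptiness test on r, so further letters at the right end are
  -- harmless.
  local-append : ∀ w {q u v q′ u′ v′} → LocalRun (q , u , v) (q′ , u′ , v′) →
                 LocalRun (q , u ++ w , v) (q′ , u′ ++ w , v′)
  local-append w = gmap (λ (q , u , v) → q , u ++ w , v) append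
    where
    append : ∀ {q u v q′ u′ v′} → LocalStep (q , u , v) (q′ , u′ , v′) →
             LocalStep (q , u ++ w , v) (q′ , u′ ++ w , v′)
    append (receive r idle)      = receive r idle
    append (receive r readʳ)     = receive r readʳ
    append (receive r readˡ)     = receive r readˡ
    append (receive r nonemptyʳ) = receive r nonemptyʳ
    append (receive r emptyˡ)    = receive r emptyˡ
    append (receive r nonemptyˡ) = receive r nonemptyˡ
    append (lose i)              = lose i

  local-nonemptyʳ : ∀ {q u v q′ a u′ v′} → LocalRun (q , u , v) (q′ , a ∷ u′ , v′) →
                    ∃[ c ] ∃[ w ] u ≡ c ∷ w
  local-nonemptyʳ ε = _ , _ , refl
  local-nonemptyʳ (receive _ idle ◅ r)      = local-nonemptyʳ r
  local-nonemptyʳ (receive _ readʳ ◅ r)     = _ , _ , refl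
  local-nonemptyʳ (receive _ readˡ ◅ r)     = local-nonemptyʳ r
  local-nonemptyʳ (receive _ nonemptyʳ ◅ r) = _ , _ , refl
  local-nonemptyʳ (receive _ emptyˡ ◅ r)    = local-nonemptyʳ r
  local-nonemptyʳ (receive _ nonemptyˡ ◅ r) = local-nonemptyʳ r
  local-nonemptyʳ (lose _ ◅ r)              = local-nonemptyʳ r

  -- While debts are outstanding there is no surplus, so l holds just the paying letter. A read
  -- consumes it; a pending non-emptiness test must work for any letter and leaves it for the next
  -- debt.
  Payment : Fin (suc m) → Rel (Q × Word m) 0ℓ
  Payment (suc a) (q , u) (q′ , u′) = LocalRun (q , u , a ∷ []) (q′ , u′ , [])
  Payment zero    (q , u) (q′ , u′) = ∀ a → LocalRun (q , u , a ∷ []) (q′ , u′ , a ∷ [])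

  -- A real Receiver waiting at the first debt, and the virtual one ahead of it.
  data Ahead : Debts → Rel (Q × Word m) 0ℓ where
    []  : ∀ {k} → Ahead [] k k
    _∷_ : ∀ {t x k k′ k″} → Payment t k k′ → Ahead x k′ k″ → Ahead (t ∷ x) k k″

  payment-append : ∀ w t {q u q′ u′} → Payment t (q , u) (q′ , u′) → Payment t (q , u ++ w) (q′ , u′ ++ w)
  payment-append w (suc a) r   = local-append w r
  payment-append w zero    r a = local-append w (r a)

  ahead-append : ∀ w {x q u q′ u′} → Ahead x (q , u) (q′ , u′) → Ahead x (q , u ++ w) (q′ , u′ ++ w)
  ahead-append w []      = []
  ahead-append w (_∷_ {t = t} r s) = payment-append w t r ∷ ahead-append w s

  ahead-nonemptyʳ : ∀ {x q u q′ a u′} → Ahead x (q , u) (q′ , a ∷ u′) → ∃[ c ] ∃[ w ] u ≡ c ∷ w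
  ahead-nonemptyʳ [] = _ , _ , refl
  ahead-nonemptyʳ (_∷_ {t = suc _} r s) with ahead-nonemptyʳ s
  ... | _ , _ , refl = local-nonemptyʳ r
  ahead-nonemptyʳ (_∷_ {t = zero} {k′ = k′} r s) with ahead-nonemptyʳ s
  -- The payment can be run only with some letter on l; the letter `c` found on r serves as one.
  ahead-nonemptyʳ (_∷_ {t = zero} {k′ = k′} r s) | c , _ , refl = local-nonemptyʳ (r c)

  ahead-snoc : ∀ {x t k k′ k″} → Ahead x k k′ → Payment t k′ k″ → Ahead (x ++ t ∷ []) k k″
  ahead-snoc []      p = p ∷ []
  ahead-snoc (r ∷ s) p = r ∷ ahead-snoc s p

  -- A move that leaves every content of l unchanged needs no debt of its own: it is appended to the
  -- payment of the last debt.
  ahead-local : ∀ {t x k q u q′ u′} → Ahead (t ∷ x) k (q , u) →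
                (∀ v → LocalRun (q , u , v) (q′ , u′ , v)) → Ahead (t ∷ x) k (q′ , u′)
  ahead-local {suc a} (r ∷ [])       f = (r ◅◅ f _) ∷ []
  ahead-local {zero}  (r ∷ [])       f = (λ a → r a ◅◅ f _) ∷ []
  ahead-local         (r ∷ s@(_ ∷ _)) f = r ∷ ahead-local s f

  ahead-commit : ∀ {t x x′ k q q′ u} → Ahead (t ∷ x) k (q , u) → Commit (t ∷ x) x′ →
                 RRule q emptyˡ q′ → Ahead x′ k (q′ , u)
  ahead-commit (r ∷ []) letter            e = (r ◅◅ receive e emptyˡ ◅ ε) ∷ []
  ahead-commit (r ∷ []) (guess {a})       e = (r a ◅◅ lose (minimum _) ◅ receive e emptyˡ ◅ ε) ∷ []
  ahead-commit (r ∷ s)  (skip c)          e = r ∷ ahead-commit s c e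

  pay-debts : ∀ {a x y x′ y′ q u t} → Balanced x y → Ahead x (q , u) t → Write a x y x′ y′ →
              ∃[ q′ ] ∃[ u′ ] LocalRun (q , u , y ++ a ∷ []) (q′ , u′ , y′) × Ahead x′ (q′ , u′) t
  pay-debts {a} {y = y} i s lose = _ , _ , lose (++⁺ʳ (a ∷ []) ⊆-refl) ◅ ε , s
  pay-debts i s (app refl) = _ , _ , ε , s
  pay-debts (inj₂ refl) (r ∷ s) pay = _ , _ , r , s
  pay-debts {a} (inj₂ refl) (r ∷ s) (pass w) =
    let _ , _ , r′ , s′ = pay-debts (inj₂ refl) s w in _ , _ , r a ◅◅ r′ , s′

  module _ (start : Config) where

    Reachable : Config → Set
    Reachable = Star ChannelStep start

    _▷_ : ∀ {c d} → Reachable c → ChannelStep c d → Reachable d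
    r ▷ s = r ◅◅ s ◅ ε

    _▷▷_ : ∀ {p l l′} → Reachable (p , l) → LocalRun l l′ → Reachable (p , l′)
    _▷▷_ {p} r s = r ◅◅ gmap (p ,_) local s

    -- The evidence behind the flag. Sender's non-emptiness test on l is performed at `earlier`, and
    -- Receiver catches up afterwards. Hence the Sender steps that preserve the flag must be
    -- possible at `earlier` too.
    record Lagging (p : P) (l : Q × Contents m) : Set where
      constructor lagging
      field
        {q} : Q
        {u} : Word m
        {a} : Fin m
        {v} : Word m
        earlier  : Reachable (p , q , u , a ∷ v)
        catch-up : LocalRun (q , u , a ∷ v) l

    record Realised (p : P) (b : Bool) (q̂ : Q) (ρ : Word m) (x : Debts) (y : Word m) : Set where
      constructor realised
      field
        {q}       : Q
        {u}       : Word m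
        reachable : Reachable (p , q , u , y)
        ahead     : Ahead x (q , u) (q̂ , ρ)
        delayed   : b ≡ true → Lagging p (q , u , y)

    realise-local : ∀ {p b q ρ x y q′ ρ′} → (∀ v → LocalRun (q , ρ , v) (q′ , ρ′ , v)) →
                    Realised p b q ρ x y → Realised p b q′ ρ′ x y
    realise-local {x = []} f (realised r [] d) =
      realised (r ▷▷ f _) [] (λ e → let lagging e c = d e in lagging e (c ◅◅ f _))
    realise-local {x = _ ∷ _} f (realised r s d) = realised r (ahead-local s f) d

    realise-balanced : ∀ {p b q ρ y q′ y′} → LocalRun (q , ρ , y) (q′ , ρ , y′) →
                       Realised p b q ρ [] y → Realised p b q′ ρ [] y′
    realise-balanced f (realised r [] d) =
      realised (r ▷▷ f) [] (λ e → let lagging e c = d e in lagging e (c ◅◅ f))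

    realise-borrow : ∀ {p b q o q′ ρ x y x′ y′} → RRule q o q′ → Borrow o x y x′ y′ → Balanced x y →
                     Realised p b q ρ x y → Realised p b q′ ρ x′ y′
    realise-borrow e idle i R = realise-local (λ _ → receive e idle ◅ ε) R
    realise-borrow e read (inj₁ refl) R = realise-balanced (receive e readˡ ◅ ε) R
    realise-borrow e owe _ (realised r s d) =
      realised r (ahead-snoc s (receive e readˡ ◅ ε)) d
    realise-borrow {x = []} e (empty none) _ R = realise-balanced (receive e emptyˡ ◅ ε) R
    realise-borrow {x = _ ∷ _} e (empty c) _ (realised r s d) = realised r (ahead-commit s c e) d
    realise-borrow e keep (inj₁ refl) R = realise-balanced (receive e nonemptyˡ ◅ ε) R
    realise-borrow e drop (inj₁ refl) R =
      realise-balanced (receive e nonemptyˡ ◅ lose (_ ∷ʳ ⊆-refl) ◅ ε) R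
    realise-borrow e pend _ (realised r s d) =
      realised r (ahead-snoc s (λ _ → receive e nonemptyˡ ◅ ε)) d

    RealisedConfig : SignedConfig → Set
    RealisedConfig (p , b , q , ρ , x , y) = Realised p b q ρ x y

    realise-step : ∀ {c d} → SignedStep c d → balanced c → RealisedConfig c → RealisedConfig d
    realise-step (transmit e) _ (realised r s d) =
      realised (r ▷ send e writeʳ) (ahead-append _ s)
        (λ b → let lagging r′ c = d b in lagging (r′ ▷ send e writeʳ) (local-append _ c))
    realise-step (send e idle) _ (realised r s d) =
      realised (r ▷ send e idle) s
        (λ b → let lagging r′ c = d b in lagging (r′ ▷ send e idle) c)
    realise-step {_ , _ , _ , _ , _ , y} (send e (write w)) i (realised r s d) with pay-debts i s w
    ... | _ , _ , f , s′ = realised (written ▷▷ f) s′ (λ _ → late y written f)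
      where
      written = r ▷ send e writeˡ
      late : ∀ {p q u a l} y → Reachable (p , q , u , y ++ a ∷ []) →
             LocalRun (q , u , y ++ a ∷ []) l → Lagging p l
      late []      r f = lagging r f
      late (_ ∷ _) r f = lagging r f
    realise-step (send e nonemptyʳ) _ (realised r s d) with ahead-nonemptyʳ s
    ... | _ , _ , refl = realised (r ▷ send e nonemptyʳ) s late
      where
      late : _ → _
      late b with d b
      ... | lagging r′ c with local-nonemptyʳ c
      ...   | _ , _ , refl = lagging (r′ ▷ send e nonemptyʳ) c
    realise-step (send e emptyˡ) _ (realised r s d) = realised (r ▷ send e emptyˡ) s (λ ())
    realise-step (send e nonemptyˡ) _ (realised r s d) with d refl
    ... | lagging r′ c = realised (r″ ▷▷ c) s (λ _ → lagging r″ c)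
      where r″ = r′ ▷ send e nonemptyˡ
    realise-step (receive e (borrow b)) i R = realise-borrow e b i R
    realise-step (receive e readʳ) _ R = realise-local (λ _ → receive e readʳ ◅ ε) R
    realise-step (receive e nonemptyʳ) _ R = realise-local (λ _ → receive e nonemptyʳ ◅ ε) R
    realise-step (sync e clear) _ (realised r [] d) = realised (r ▷ sync e) [] (λ ())
    realise-step (sync e keep) _ (realised r [] d) = realised r′ [] (λ _ → lagging r′ ε)
      where r′ = r ▷ sync e
    realise-step (sync e drop) _ (realised r [] d) =
      realised (r′ ▷▷ f) [] (λ _ → lagging r′ f)
      where
      r′ = r ▷ sync e
      f = lose (_ ∷ʳ ⊆-refl) ◅ ε

  realise : ∀ {p q p′ b′ q′} →
            Star SignedStep (p , false , q , [] , [] , []) (p′ , b′ , q′ , [] , [] , []) →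
            Star ChannelStep (p , q , [] , []) (p′ , q′ , [] , [])
  realise {p} {q} = go (inj₁ refl) (realised ε [] (λ ()))
    where
    go : ∀ {c p′ b′ q′} → balanced c → RealisedConfig (p , q , [] , []) c →
         Star SignedStep c (p′ , b′ , q′ , [] , [] , []) →
         Star ChannelStep (p , q , [] , []) (p′ , q′ , [] , [])
    go i (realised r [] d) ε = r
    go i R (s ◅ r) = go (step-balanced s i) (realise-step _ s i R) r

  -- From runs to capped signed runs

  module _ {pᶠ : P} {qᶠ : Q} where

    Accepting : Rel SignedConfig 0ℓ → SignedConfig → Set
    Accepting S c = ∃[ b ] Star S c (pᶠ , b , qᶠ , [] , [] , [])

    _◁_ : ∀ {S : Rel SignedConfig 0ℓ} {c d} → S c d → Accepting S d → Accepting S c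
    s ◁ (b , r) = b , s ◅ r

    -- No debts arise at this stage. The surplus `y` keeps those letters of `v` that the rest of the
    -- run still uses, so that loss steps disappear; it is found by working back from the end of the
    -- run.
    SignedFrom : P → Bool → Q → Contents m → Set
    SignedFrom p b q (u , v) = ∃[ y ] y ⊆ v × Accepting SignedStep (p , b , q , u , [] , y)

    -- Sender's non-emptiness test may rely on a letter of the true content that is lost later and
    -- so is missing from `y`. The flag must therefore follow the true content `v`.
    Flags : Bool → Word m → Set
    Flags b v = b ≡ true ⊎ v ≡ []

    signed-send : ∀ {p o p′ b q k k′} → SRule p o p′ → Send o k k′ → Flags b (proj₂ k) →
                  (∀ {b′} → Flags b′ (proj₂ k′) → SignedFrom p′ b′ q k′) → SignedFrom p b q k
    signed-send e idle f R = let y , i , r = R f in y , i , send e idle ◁ r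
    signed-send e writeʳ f R = let y , i , r = R f in y , i , transmit e ◁ r
    signed-send {k = _ , v} e writeˡ f R with R (inj₁ refl)
    ... | y , i , r with ⊆-snoc⁻ v i
    ...   | inj₁ j = y , j , send e (write lose) ◁ r
    ...   | inj₂ (y′ , refl , j) = y′ , j , send e (write (app refl)) ◁ r
    signed-send e nonemptyʳ f R = let y , i , r = R f in y , i , send e nonemptyʳ ◁ r
    signed-send e emptyˡ f R with R (inj₂ refl)
    ... | [] , i , r = [] , i , send e emptyˡ ◁ r
    signed-send e nonemptyˡ (inj₁ refl) R =
      let y , i , r = R (inj₁ refl) in y , i , send e nonemptyˡ ◁ r

    signed-receive : ∀ {p b q o q′ k k′} → RRule q o q′ → Receive o k k′ → Flags b (proj₂ k) →
                     (∀ {b′} → Flags b′ (proj₂ k′) → SignedFrom p b′ q′ k′) → SignedFrom p b q k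
    signed-receive e idle f R = let y , i , r = R f in y , i , receive e (borrow idle) ◁ r
    signed-receive e readʳ f R = let y , i , r = R f in y , i , receive e readʳ ◁ r
    signed-receive e readˡ (inj₁ refl) R =
      let y , i , r = R (inj₁ refl) in _ , refl ∷ i , receive e (borrow read) ◁ r
    signed-receive e nonemptyʳ f R = let y , i , r = R f in y , i , receive e nonemptyʳ ◁ r
    signed-receive e emptyˡ f R with R f
    ... | [] , i , r = [] , i , receive e (borrow (empty none)) ◁ r
    signed-receive e nonemptyˡ f R with R f
    ... | []    , i , r = _ , refl ∷ minimum _ , receive e (borrow drop) ◁ r
    ... | _ ∷ _ , i , r = _ , i , receive e (borrow keep) ◁ r

    signed-sync : ∀ {p b q p′ q′ v} → Sync p q p′ q′ →
                  (∀ {b′} → Flags b′ v → SignedFrom p′ b′ q′ ([] , v)) → SignedFrom p b q ([] , v)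
    signed-sync {v = []} e R with R {false} (inj₂ refl)
    ... | [] , i , r = [] , i , sync e clear ◁ r
    signed-sync {v = _ ∷ _} e R with R (inj₁ refl)
    ... | []    , i , r = _ , refl ∷ minimum _ , sync e drop ◁ r
    ... | _ ∷ _ , i , r = _ , i , sync e keep ◁ r

    lossy-flags : ∀ {b v v′} → v′ ⊆ v → Flags b v → Flags b v′
    lossy-flags i  (inj₁ e)    = inj₁ e
    lossy-flags [] (inj₂ refl) = inj₂ refl

    signed : ∀ {p b q u v} → Flags b v → Star ChannelStep (p , q , u , v) (pᶠ , qᶠ , [] , []) →
             SignedFrom p b q (u , v)
    signed f ε = [] , [] , _ , ε
    signed f (send e s ◅ r) = signed-send e s f (λ g → signed g r)
    signed f (local (receive e s) ◅ r) = signed-receive e s f (λ g → signed g r)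
    signed f (local (lose i) ◅ r) = let y , j , R = signed (lossy-flags i f) r in y , ⊆-trans j i , R
    signed f (sync e ◅ r) = signed-sync e (λ g → signed g r)

    -- Receiver's steps are advanced past Sender's until r holds one letter.

    Signed : Set
    Signed = Q × Word m × Debts × Word m

    -- Receiver moves only while r holds at least two letters, so that r stays non-empty and
    -- Sender's non-emptiness test on r remains possible. Joint moves have r empty and are never
    -- overtaken.
    data Advance : Rel Signed 0ℓ where
      arrive : ∀ {q a x y} → Advance (q , a ∷ [] , x , y) (q , a ∷ [] , x , y)
      more   : ∀ {q a c ρ x y o q′ k′ l} → RRule q o q′ → SignedReceive o (a ∷ c ∷ ρ , x , y) k′ →
               Advance (q′ , k′) l → Advance (q , a ∷ c ∷ ρ , x , y) l

    Capped : SignedConfig → Set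
    Capped = Accepting CappedStep

    CappedFrom : SignedConfig → Set
    CappedFrom c@(_ , _ , _ , [] , _)        = Capped c
    CappedFrom   (p , b , l@(_ , _ ∷ _ , _)) = ∃[ l′ ] Advance l l′ × Capped (p , b , l′)

    advance-short : ∀ {l l′} → Advance l l′ → length (proj₁ (proj₂ l′)) ≤ 1
    advance-short arrive       = s≤s z≤n
    advance-short (more _ _ A) = advance-short A

    -- Sender's emptiness test on l asks only that there be no surplus; debts do not violate it, and
    -- without a surplus Receiver can only add or commit debts. Writes are exchanged by
    -- `write-borrow`.
    commute : ∀ {o o′ b b′ a c ρ x y k₁ k₂} → SignedSend o (b , a ∷ c ∷ ρ , x , y) (b′ , k₁) →
              SignedReceive o′ k₁ k₂ →
              ∃[ k′ ] SignedReceive o′ (a ∷ c ∷ ρ , x , y) k′ × SignedSend o (b , k′) (b′ , k₂)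
    commute idle      r             = _ , r , idle
    commute (write w) (borrow b)    = let _ , _ , b′ , w′ = write-borrow w b in _ , borrow b′ , write w′
    commute (write w) readʳ         = _ , readʳ , write w
    commute (write w) nonemptyʳ     = _ , nonemptyʳ , write w
    commute nonemptyʳ (borrow b)    = _ , borrow b , nonemptyʳ
    commute nonemptyʳ readʳ         = _ , readʳ , nonemptyʳ
    commute nonemptyʳ nonemptyʳ     = _ , nonemptyʳ , nonemptyʳ
    commute nonemptyˡ r             = _ , r , nonemptyˡ
    commute emptyˡ readʳ            = _ , readʳ , emptyˡ
    commute emptyˡ nonemptyʳ        = _ , nonemptyʳ , emptyˡ
    commute emptyˡ (borrow idle)      = _ , borrow idle , emptyˡ
    commute emptyˡ (borrow owe)       = _ , borrow owe , emptyˡ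
    commute emptyˡ (borrow (empty c)) = _ , borrow (empty c) , emptyˡ
    commute emptyˡ (borrow pend)      = _ , borrow pend , emptyˡ

    same-ρ : ∀ {o b ρ x y b′ ρ′ x′ y′} → SignedSend o (b , ρ , x , y) (b′ , ρ′ , x′ , y′) → ρ′ ≡ ρ
    same-ρ idle      = refl
    same-ρ (write _) = refl
    same-ρ nonemptyʳ = refl
    same-ρ emptyˡ    = refl
    same-ρ nonemptyˡ = refl

    commute-advance : ∀ {o b b′ q a ρ x y k₁ l} → SignedSend o (b , a ∷ ρ , x , y) (b′ , k₁) →
                      Advance (q , k₁) l →
                      ∃[ k′ ] Advance (q , a ∷ ρ , x , y) (proj₁ l , k′) ×
                              SignedSend o (b , k′) (b′ , proj₂ l)
    commute-advance s A with same-ρ s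
    commute-advance s arrive | refl = _ , arrive , s
    commute-advance s (more e r A) | refl with commute s r
    ... | ([] , _) , () , _
    ... | (_ ∷ _ , _) , r′ , s′ = let _ , A′ , s″ = commute-advance s′ A in _ , more e r′ A′ , s″

    Postponed : P → Bool → Fin m → Signed → Signed → Set
    Postponed p b d l l′ = ∃[ l₁ ] ∃[ q′ ] ∃[ x′ ] ∃[ y′ ] Advance l l₁ ×
      Star CappedStep (p , b , l₁) (p , b , q′ , [] , x′ , y′) × l′ ≡ (q′ , d ∷ [] , x′ , y′)

    -- After the advance the one letter left is the new `d`, so Receiver has read all older ones.
    -- The last of these is now read in capped steps, which empties r, and only then is `d` written.
    postpone-transmit : ∀ p b {d q x y l} a ρ → Advance (q , a ∷ ρ ++ d ∷ [] , x , y) l →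
                        Postponed p b d (q , a ∷ ρ , x , y) l
    postpone-transmit p b a [] (more e (borrow r) A) with postpone-transmit p b a [] A
    ... | _ , _ , _ , _ , arrive , S , E = _ , _ , _ , _ , arrive , (receive e (borrow r) , s≤s z≤n) ◅ S , E
    postpone-transmit p b a [] (more e nonemptyʳ A) with postpone-transmit p b a [] A
    ... | _ , _ , _ , _ , arrive , S , E = _ , _ , _ , _ , arrive , (receive e nonemptyʳ , s≤s z≤n) ◅ S , E
    postpone-transmit p b a [] (more e readʳ arrive) =
      _ , _ , _ , _ , arrive , (receive e readʳ , z≤n) ◅ ε , refl
    postpone-transmit p b a (c ∷ ρ) (more e (borrow r) A) =
      let _ , _ , _ , _ , A′ , S , E = postpone-transmit p b a (c ∷ ρ) A
      in _ , _ , _ , _ , more e (borrow r) A′ , S , E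
    postpone-transmit p b a (c ∷ ρ) (more e nonemptyʳ A) =
      let _ , _ , _ , _ , A′ , S , E = postpone-transmit p b a (c ∷ ρ) A
      in _ , _ , _ , _ , more e nonemptyʳ A′ , S , E
    postpone-transmit p b a (c ∷ ρ) (more e readʳ A) =
      let _ , _ , _ , _ , A′ , S , E = postpone-transmit p b c ρ A
      in _ , _ , _ , _ , more e readʳ A′ , S , E

    capped-from-short : ∀ {c} → length (ρ-of c) ≤ 1 → CappedFrom c → Capped c
    capped-from-short {_ , _ , _ , [] , _}     _        C                = C
    capped-from-short {_ , _ , _ , _ ∷ [] , _} _        (_ , arrive , C) = C
    capped-from-short {_ , _ , _ , _ ∷ _ ∷ _ , _} (s≤s ()) _

    short-capped-from : ∀ {c} → length (ρ-of c) ≤ 1 → Capped c → CappedFrom c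
    short-capped-from {_ , _ , _ , [] , _}     _ C = C
    short-capped-from {_ , _ , _ , _ ∷ [] , _} _ C = _ , arrive , C
    short-capped-from {_ , _ , _ , _ ∷ _ ∷ _ , _} (s≤s ()) _

    short-step : ∀ {c d} → length (ρ-of c) ≤ 1 → length (ρ-of d) ≤ 1 → SignedStep c d →
                 CappedFrom d → CappedFrom c
    short-step i j s C = short-capped-from i ((s , j) ◁ capped-from-short j C)

    capped-step : ∀ {c d} → SignedStep c d → CappedFrom d → CappedFrom c
    capped-step s@(sync _ _) C = short-step z≤n z≤n s C
    capped-step {_ , _ , _ , [] , _} s@(transmit _) C = short-step z≤n (s≤s z≤n) s C
    capped-step {p , b , _ , a ∷ ρ , _} (transmit e) (_ , A , C) with postpone-transmit p b a ρ A
    ... | l , _ , _ , _ , A′ , S , refl =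
      let b′ , R = (transmit e , s≤s z≤n) ◁ C in l , A′ , b′ , S ◅◅ R
    capped-step {_ , _ , _ , [] , _} s@(send _ s′) C with same-ρ s′
    ... | refl = short-step z≤n z≤n s C
    capped-step {_ , _ , _ , _ ∷ ρ , _} s@(send e s′) C with same-ρ s′
    capped-step {_ , _ , _ , _ ∷ [] , _} s@(send e s′) C | refl = short-step (s≤s z≤n) (s≤s z≤n) s C
    capped-step {_ , _ , _ , _ ∷ _ ∷ _ , _} s@(send e s′) (l , A , C) | refl with commute-advance s′ A
    ... | k , A′ , s″ = _ , A′ , (send e s″ , advance-short A) ◁ C
    capped-step {_ , _ , _ , [] , _} s@(receive _ (borrow _)) C = short-step z≤n z≤n s C
    capped-step {_ , _ , _ , _ ∷ [] , _} s@(receive _ (borrow _)) C = short-step (s≤s z≤n) (s≤s z≤n) s C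
    capped-step {_ , _ , _ , _ ∷ [] , _} s@(receive _ readʳ) C = short-step (s≤s z≤n) z≤n s C
    capped-step {_ , _ , _ , _ ∷ [] , _} s@(receive _ nonemptyʳ) C = short-step (s≤s z≤n) (s≤s z≤n) s C
    capped-step {_ , _ , _ , _ ∷ _ ∷ _ , _} (receive e r@(borrow _)) (l , A , C) = l , more e r A , C
    capped-step {_ , _ , _ , _ ∷ _ ∷ _ , _} (receive e r@readʳ) (l , A , C) = l , more e r A , C
    capped-step {_ , _ , _ , _ ∷ _ ∷ _ , _} (receive e r@nonemptyʳ) (l , A , C) = l , more e r A , C

    capped : ∀ {c} → Accepting SignedStep c → CappedFrom c
    capped (b , ε)     = b , ε
    capped (b , s ◅ r) = capped-step s (capped (b , r))

-- Deciding reachability by cutting capped signed runs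

write-≤-debts : ∀ {m} {a : Fin m} {x y x′ y′} → Write a x y x′ y′ → length x′ ≤ length x
write-≤-debts lose     = ≤-refl
write-≤-debts (app _)  = ≤-refl
write-≤-debts pay      = n≤1+n _
write-≤-debts (pass w) = ≤-trans (write-≤-debts w) (n≤1+n _)

write-≥-surplus : ∀ {m} {a : Fin m} {x y x′ y′} → Write a x y x′ y′ → length y ≤ length y′
write-≥-surplus lose     = ≤-refl
write-≥-surplus {y = y} (app refl) = ≤-trans (m≤m+n _ _) (≤-reflexive (sym (length-++ y)))
write-≥-surplus pay      = ≤-refl
write-≥-surplus (pass w) = write-≥-surplus w

length-snoc : ∀ {A : Set} x {a : A} → length (x ++ a ∷ []) ≡ suc (length x)
length-snoc x = trans (length-++ x) (+-comm _ 1)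

commit-length : ∀ {m} {x x′ : List (Fin (suc m))} → Commit x x′ → length x′ ≡ length x
commit-length none     = refl
commit-length letter   = refl
commit-length guess    = refl
commit-length (skip c) = cong suc (commit-length c)

borrow-≤-debts : ∀ {m} {o : Op m} {x y x′ y′} → Borrow o x y x′ y′ →
                 length x′ ≤ suc (length x) × (¬ y ≡ [] → length x′ ≤ length x)
borrow-≤-debts idle      = n≤1+n _ , λ _ → ≤-refl
borrow-≤-debts read      = n≤1+n _ , λ _ → ≤-refl
borrow-≤-debts (owe {x = x})       = ≤-reflexive (length-snoc x) , λ y≢[] → contradiction refl y≢[]
borrow-≤-debts (empty c) = ≤-trans (≤-reflexive (commit-length c)) (n≤1+n _) , λ _ → ≤-reflexive (commit-length c)
borrow-≤-debts keep      = n≤1+n _ , λ _ → ≤-refl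
borrow-≤-debts drop      = n≤1+n _ , λ _ → ≤-refl
borrow-≤-debts (pend {x = x})      = ≤-reflexive (length-snoc x) , λ y≢[] → contradiction refl y≢[]

borrow-≥-surplus : ∀ {m} {o : Op m} {x y x′ y′} → Borrow o x y x′ y′ → length y ≤ suc (length y′)
borrow-≥-surplus idle      = n≤1+n _
borrow-≥-surplus read      = ≤-refl
borrow-≥-surplus owe       = z≤n
borrow-≥-surplus (empty _) = z≤n
borrow-≥-surplus keep      = n≤1+n _
borrow-≥-surplus drop      = ≤-refl
borrow-≥-surplus pend      = z≤n

-- Successors are never listed. Deciding for each decidable `G` whether some successor satisfies it
-- allows the deciders for rules, debts and contents to be nested, `G` carrying the rest of the
-- search.
write? : ∀ {m} (a : Fin m) x y {G : List (Fin (suc m)) → Word m → Set} → (∀ x y → Dec (G x y)) →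
         Dec (∃[ x′ ] ∃[ y′ ] Write a x y x′ y′ × G x′ y′)
write? a [] y G? = map′
  (λ { (inj₁ g) → _ , _ , lose , g ; (inj₂ g) → _ , _ , app refl , g })
  (λ { (_ , _ , lose , g) → inj₁ g ; (_ , _ , app refl , g) → inj₂ g })
  (G? [] y ⊎-dec G? [] (y ++ a ∷ []))
write? a (zero ∷ x) y G? = map′
  (λ { (inj₁ g) → _ , _ , lose , g ; (inj₂ (_ , _ , w , g)) → _ , _ , pass w , g })
  (λ { (_ , _ , lose , g) → inj₁ g ; (_ , _ , pass w , g) → inj₂ (_ , _ , w , g) })
  (G? (zero ∷ x) y ⊎-dec write? a x y G?)
write? a (suc b ∷ x) y G? = map′
  (λ { (inj₁ g) → _ , _ , lose , g ; (inj₂ (refl , g)) → _ , _ , pay , g })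
  (λ { (_ , _ , lose , g) → inj₁ g ; (_ , _ , pay , g) → inj₂ (refl , g) })
  (G? (suc b ∷ x) y ⊎-dec a ≟ᶠ b ×-dec G? x y)

commit? : ∀ {m} x {G : List (Fin (suc m)) → Set} → (∀ x → Dec (G x)) → Dec (∃[ x′ ] Commit x x′ × G x′)
commit? []           G? = map′ (λ g → _ , none , g) (λ { (_ , none , g) → g }) (G? [])
commit? (suc a ∷ []) G? = map′ (λ g → _ , letter , g) (λ { (_ , letter , g) → g }) (G? (suc a ∷ []))
commit? (zero ∷ [])  G? = map′ (λ (_ , g) → _ , guess , g) (λ { (_ , guess , g) → _ , g })
                            (any? (λ a → G? (suc a ∷ [])))
commit? (s ∷ t ∷ x)  G? = map′ (λ (_ , c , g) → _ , skip c , g) (λ { (_ , skip c , g) → _ , c , g })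
                            (commit? (t ∷ x) (λ x → G? (s ∷ x)))

borrow? : ∀ {m} (o : Op m) x y {G : List (Fin (suc m)) → Word m → Set} → (∀ x y → Dec (G x y)) →
          Dec (∃[ x′ ] ∃[ y′ ] Borrow o x y x′ y′ × G x′ y′)
borrow? idle      x y       G? = map′ (λ g → _ , _ , idle , g) (λ { (_ , _ , idle , g) → g }) (G? x y)
borrow? nonemptyʳ x y       G? = no λ ()
borrow? (onʳ _)   x y       G? = no λ ()
borrow? (onˡ a)   x []      G? = map′ (λ g → _ , _ , owe , g) (λ { (_ , _ , owe , g) → g })
                                   (G? (x ++ suc a ∷ []) [])
borrow? (onˡ a)   x (b ∷ y) G? = map′ (λ { (refl , g) → _ , _ , read , g })
                                   (λ { (_ , _ , read , g) → refl , g }) (a ≟ᶠ b ×-dec G? x y)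
borrow? emptyˡ    x []      G? = map′ (λ (_ , c , g) → _ , _ , empty c , g)
                                   (λ { (_ , _ , empty c , g) → _ , c , g }) (commit? x (λ x → G? x []))
borrow? emptyˡ    x (_ ∷ _) G? = no λ ()
borrow? nonemptyˡ x []      G? = map′ (λ g → _ , _ , pend , g) (λ { (_ , _ , pend , g) → g })
                                   (G? (x ++ zero ∷ []) [])
borrow? nonemptyˡ x (b ∷ y) G? = map′
  (λ { (inj₁ g) → _ , _ , keep , g ; (inj₂ g) → _ , _ , drop , g })
  (λ { (_ , _ , keep , g) → inj₁ g ; (_ , _ , drop , g) → inj₂ g })
  (G? x (b ∷ y) ⊎-dec G? x y)

-- Signed runs can be cut

module _ (S : System) where
  open System S
  open Semantics′ S

  debts surplus : SignedConfig → ℕ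
  debts   (_ , _ , _ , _ , x , _) = length x
  surplus (_ , _ , _ , _ , _ , y) = length y

  Indebted : SignedConfig → Set
  Indebted (_ , _ , _ , _ , _ , y) = y ≡ []

  indebted? : Decidable Indebted
  indebted? (_ , _ , _ , _ , _ , [])    = yes refl
  indebted? (_ , _ , _ , _ , _ , _ ∷ _) = no λ ()

  step-debts : ∀ {c d} → SignedStep c d →
               debts d ≤ suc (debts c) × (¬ Indebted c → debts d ≤ debts c)
  step-debts (transmit _)           = n≤1+n _ , λ _ → ≤-refl
  step-debts (send _ idle)          = n≤1+n _ , λ _ → ≤-refl
  step-debts (send _ (write w))     = ≤-trans (write-≤-debts w) (n≤1+n _) , λ _ → write-≤-debts w
  step-debts (send _ nonemptyʳ)     = n≤1+n _ , λ _ → ≤-refl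
  step-debts (send _ emptyˡ)        = n≤1+n _ , λ _ → ≤-refl
  step-debts (send _ nonemptyˡ)     = n≤1+n _ , λ _ → ≤-refl
  step-debts (receive _ (borrow b)) = borrow-≤-debts b
  step-debts (receive _ readʳ)      = n≤1+n _ , λ _ → ≤-refl
  step-debts (receive _ nonemptyʳ)  = n≤1+n _ , λ _ → ≤-refl
  step-debts (sync _ _)             = z≤n , λ _ → z≤n

  step-surplus : ∀ {c d} → SignedStep c d → surplus c ≤ suc (surplus d)
  step-surplus (transmit _)           = n≤1+n _
  step-surplus (send _ idle)          = n≤1+n _
  step-surplus (send _ (write w))     = ≤-trans (write-≥-surplus w) (n≤1+n _)
  step-surplus (send _ nonemptyʳ)     = n≤1+n _
  step-surplus (send _ emptyˡ)        = z≤n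
  step-surplus (send _ nonemptyˡ)     = n≤1+n _
  step-surplus (receive _ (borrow b)) = borrow-≥-surplus b
  step-surplus (receive _ readʳ)      = n≤1+n _
  step-surplus (receive _ nonemptyʳ)  = n≤1+n _
  step-surplus (sync _ clear)         = n≤1+n _
  step-surplus (sync _ keep)          = n≤1+n _
  step-surplus (sync _ drop)          = ≤-refl

  step-mono : ∀ {p b q ρ x y p′ b′ q′ ρ′ x′ y′ d} →
              SignedStep (p , b , q , ρ , x , y) (p′ , b′ , q′ , ρ′ , x′ , y′) → d ⊆ x →
              ∃[ d′ ] d′ ⊆ x′ × SignedStep (p , b , q , ρ , d , y) (p′ , b′ , q′ , ρ′ , d′ , y′)
  step-mono (transmit e)       i = _ , i , transmit e
  step-mono (send e idle)      i = _ , i , send e idle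
  step-mono (send e (write w)) i = let _ , j , w′ = write-mono w i in _ , j , send e (write w′)
  step-mono (send e nonemptyʳ) i = _ , i , send e nonemptyʳ
  step-mono (send e emptyˡ)    i = _ , i , send e emptyˡ
  step-mono (send e nonemptyˡ) i = _ , i , send e nonemptyˡ
  step-mono (receive e (borrow b)) i =
    let _ , j , b′ = borrow-mono b i in _ , j , receive e (borrow b′)
  step-mono (receive e readʳ)     i = _ , i , receive e readʳ
  step-mono (receive e nonemptyʳ) i = _ , i , receive e nonemptyʳ
  step-mono (sync e t) [] = _ , [] , sync e t

  settle-back : ∀ {y y′ d′ b} → Settle y b y′ → d′ ⊆ y′ → ∃[ d ] d ⊆ y × Settle d b d′
  settle-back clear i = _ , i , clear
  settle-back {d′ = []}    keep i = _ , refl ∷ minimum _ , drop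
  settle-back {d′ = _ ∷ _} keep i = _ , i , keep
  settle-back drop i = _ , refl ∷ i , drop

  step-back : ∀ {p b q ρ x y p′ b′ q′ ρ′ x′ y′ d′} →
              SignedStep (p , b , q , ρ , x , y) (p′ , b′ , q′ , ρ′ , x′ , y′) → d′ ⊆ y′ →
              ∃[ d ] d ⊆ y × SignedStep (p , b , q , ρ , x , d) (p′ , b′ , q′ , ρ′ , x′ , d′)
  step-back (transmit e)       i = _ , i , transmit e
  step-back (send e idle)      i = _ , i , send e idle
  step-back (send e (write w)) i = let _ , j , w′ = write-back w i in _ , j , send e (write w′)
  step-back (send e nonemptyʳ) i = _ , i , send e nonemptyʳ
  step-back (send e emptyˡ)    [] = _ , [] , send e emptyˡ
  step-back (send e nonemptyˡ) i = _ , i , send e nonemptyˡ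
  step-back (receive e (borrow b)) i =
    let _ , j , b′ = borrow-back b i in _ , j , receive e (borrow b′)
  step-back (receive e readʳ)     i = _ , i , receive e readʳ
  step-back (receive e nonemptyʳ) i = _ , i , receive e nonemptyʳ
  step-back (sync e t) i = let _ , j , t′ = settle-back t i in _ , j , sync e t′

  module _ {pᶠ : P} {bᶠ : Bool} {qᶠ : Q} where

    path-mono : ∀ {n p b q ρ x y d} → d ⊆ x →
                Path CappedStep n (p , b , q , ρ , x , y) (pᶠ , bᶠ , qᶠ , [] , [] , []) →
                Path CappedStep n (p , b , q , ρ , d , y) (pᶠ , bᶠ , qᶠ , [] , [] , [])
    path-mono [] [] = []
    path-mono i ((s , l) ∷ p) = let _ , j , s′ = step-mono s i in (s′ , l) ∷ path-mono j p

  path-back : ∀ {n p₀ b₀ q₀ ρ₀ x₀ y₀ p b q ρ x y d} → d ⊆ y →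
              Path CappedStep n (p₀ , b₀ , q₀ , ρ₀ , x₀ , y₀) (p , b , q , ρ , x , y) →
              ∃[ d₀ ] d₀ ⊆ y₀ ×
                Path CappedStep n (p₀ , b₀ , q₀ , ρ₀ , x₀ , d₀) (p , b , q , ρ , x , d)
  path-back i []            = _ , i , []
  path-back i ((s , l) ∷ p) =
    let _ , j , p′ = path-back i p
        _ , k , s′ = step-back s j
    in _ , k , (s′ , l) ∷ p′

  first-letter : Word m → Fin (suc m)
  first-letter []      = zero
  first-letter (a ∷ _) = suc a

  first-letter-injective : ∀ {u v} → length u ≤ 1 → length v ≤ 1 →
                           first-letter u ≡ first-letter v → u ≡ v
  first-letter-injective {[]}     {[]}     _ _ _    = refl
  first-letter-injective {_ ∷ []} {_ ∷ []} _ _ refl = refl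
  first-letter-injective {_ ∷ _ ∷ _} (s≤s ()) _ _
  first-letter-injective {_ ∷ []} {_ ∷ _ ∷ _} _ (s≤s ()) _

  bit : Bool → Fin 2
  bit false = zero
  bit true  = suc zero

  bit-injective : ∀ {b c} → bit b ≡ bit c → b ≡ c
  bit-injective {false} {false} _ = refl
  bit-injective {true}  {true}  _ = refl

  open Finite (finite-op {m}) using () renaming (exists? to existsᵒ?)
  open Finite P-finite using () renaming (to to toᵖ; to-injective to toᵖ-injective; exists? to existsᵖ?; _≟_ to _≟ᵖ_)
  open Finite Q-finite using () renaming (to to toᵠ; to-injective to toᵠ-injective; exists? to existsᵠ?; _≟_ to _≟ᵠ_)

  control : P × Bool × Q × Word m → Fin _
  control (p , b , q , ρ) = combine (combine (toᵖ p) (bit b)) (combine (toᵠ q) (first-letter ρ))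

  control-injective : ∀ {p b q ρ p′ b′ q′ ρ′} → length ρ ≤ 1 → length ρ′ ≤ 1 →
                      control (p , b , q , ρ) ≡ control (p′ , b′ , q′ , ρ′) →
                      (p , b , q , ρ) ≡ (p′ , b′ , q′ , ρ′)
  control-injective i j e =
    let e₁ , e₂ = combine-injective _ _ _ _ e
        ep , eb = combine-injective _ _ _ _ e₁
        eq , eρ = combine-injective _ _ _ _ e₂
    in cong₂ _,_ (toᵖ-injective ep) (cong₂ _,_ (bit-injective eb)
         (cong₂ _,_ (toᵠ-injective eq) (first-letter-injective i j eρ)))

  debt-code : SignedConfig → Fin _ × List (Fin (suc m))
  debt-code (p , b , q , ρ , x , _) = control (p , b , q , ρ) , x

  surplus-code : SignedConfig → Fin _ × Word m
  surplus-code (p , b , q , ρ , _ , y) = control (p , b , q , ρ) , y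

  short : SignedConfig → Set
  short c = length (ρ-of c) ≤ 1

  pred-≤ : ∀ {i j} → i ≤ suc j → ¬ j ≡ 0 → pred i ≤ suc (pred j)
  pred-≤ {zero}           _       _   = z≤n
  pred-≤ {suc i} {zero}  (s≤s l) j≢0 = contradiction refl j≢0
  pred-≤ {suc i} {suc j} (s≤s l) _   = l

  n≤suc-pred : ∀ n → n ≤ suc (pred n)
  n≤suc-pred zero    = z≤n
  n≤suc-pred (suc n) = ≤-refl

  cuttable : ∀ {p q p′ b q′} →
             Cuttable CappedStep (p , false , q , [] , [] , []) (p′ , b , q′ , [] , [] , [])
  cuttable = record
    { K?         = indebted?
    ; code       = debt-code
    ; size       = debts
    ; code-size  = λ _ → n≤1+n _
    ; grow-K     = λ (s , _) _ → proj₁ (step-debts s)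
    ; grow-¬K    = λ (s , _) → proj₂ (step-debts s)
    ; size-start = refl
    ; code′      = surplus-code
    -- Read backwards, the surplus may grow from zero to one letter at a configuration without
    -- surplus, which does not count as a visit. Taking `pred` absorbs that letter, and the `suc` in
    -- `code-size′` makes up for it.
    ; size′      = pred ∘ surplus
    ; code-size′ = λ _ → n≤suc-pred _
    ; shrink-¬K  = λ { {d = _ , _ , _ , _ , _ , []} _ ¬k → contradiction refl ¬k
                     ; {d = _ , _ , _ , _ , _ , _ ∷ _} (s , _) _ → pred-≤ (step-surplus s) λ () }
    ; shrink-K   = λ { (s , _) refl → pred-≤0 (step-surplus s) }
    ; size′-end  = refl
    ; continue   = continue
    ; precede    = precede
    }
    where
    pred-≤0 : ∀ {i} → i ≤ 1 → pred i ≤ 0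
    pred-≤0 z≤n       = z≤n
    pred-≤0 (s≤s z≤n) = z≤n

    path-short : ∀ {n p b q x y c} → Path CappedStep n (p , b , q , [] , x , y) c → short c
    path-short r = path-invariant {I = short} (λ (_ , l) _ → l) r z≤n

    path-balanced : ∀ {n c d} → Path CappedStep n c d → balanced c → balanced d
    path-balanced = path-invariant {I = balanced} (λ (s , _) → step-balanced s)

    continue : ∀ {p q p′ b q′ i j k c d} → Indebted c → Indebted d →
               debt-code c ⊑ debt-code d →
               Path CappedStep i (p , false , q , [] , [] , []) c →
               Path CappedStep j (p , false , q , [] , [] , []) d →
               Path CappedStep k d (p′ , b , q′ , [] , [] , []) →
               Path CappedStep k c (p′ , b , q′ , [] , [] , [])
    continue refl refl (e , s) r r′ t
      with control-injective (path-short r) (path-short r′) e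
    ... | refl = path-mono s t

    precede : ∀ {p q i j c d} → ¬ Indebted c → ¬ Indebted d →
              surplus-code d ⊑ surplus-code c →
              Path CappedStep i (p , false , q , [] , [] , []) c →
              Path CappedStep j (p , false , q , [] , [] , []) d →
              Path CappedStep i (p , false , q , [] , [] , []) d
    precede ¬k ¬l (e , s) r r′
      -- A non-empty surplus excludes debts, so control and surplus determine the whole
      -- configuration.
      with path-balanced r (inj₁ refl) | path-balanced r′ (inj₁ refl)
    ... | inj₂ y≡[] | _         = contradiction y≡[] ¬k
    ... | inj₁ _    | inj₂ y≡[] = contradiction y≡[] ¬l
    ... | inj₁ refl | inj₁ refl with control-injective (path-short r′) (path-short r) e | path-back s r
    -- The start has no surplus, and its only subword is itself, so the modified history begins at
    -- the same configuration.
    ...   | refl | [] , [] , r″ = r″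

  -- Decidability of the signed steps

  signed-send? : ∀ o b ρ x y {G : Bool → Word m → Debts → Word m → Set} →
                 (∀ b ρ x y → Dec (G b ρ x y)) →
                 Dec (∃[ b′ ] ∃[ ρ′ ] ∃[ x′ ] ∃[ y′ ]
                      SignedSend o (b , ρ , x , y) (b′ , ρ′ , x′ , y′) × G b′ ρ′ x′ y′)
  signed-send? idle b ρ x y G? =
    map′ (λ g → _ , _ , _ , _ , idle , g) (λ { (_ , _ , _ , _ , idle , g) → g }) (G? b ρ x y)
  signed-send? nonemptyʳ b []      x y G? = no λ ()
  signed-send? nonemptyʳ b (a ∷ ρ) x y G? =
    map′ (λ g → _ , _ , _ , _ , nonemptyʳ , g) (λ { (_ , _ , _ , _ , nonemptyʳ , g) → g }) (G? b (a ∷ ρ) x y)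
  signed-send? emptyˡ b ρ x []      G? =
    map′ (λ g → _ , _ , _ , _ , emptyˡ , g) (λ { (_ , _ , _ , _ , emptyˡ , g) → g }) (G? false ρ x [])
  signed-send? emptyˡ b ρ x (_ ∷ _) G? = no λ ()
  signed-send? nonemptyˡ false ρ x y G? = no λ ()
  signed-send? nonemptyˡ true  ρ x y G? =
    map′ (λ g → _ , _ , _ , _ , nonemptyˡ , g) (λ { (_ , _ , _ , _ , nonemptyˡ , g) → g }) (G? true ρ x y)
  signed-send? (onʳ _) b ρ x y G? = no λ ()
  signed-send? (onˡ a) b ρ x y G? =
    map′ (λ (_ , _ , w , g) → _ , _ , _ , _ , write w , g)
         (λ { (_ , _ , _ , _ , write w , g) → _ , _ , w , g }) (write? a x y (G? true ρ))

  data OnR : Op m → Rel (Word m) 0ℓ where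
    readʳ     : ∀ {a ρ} → OnR (onʳ a) (a ∷ ρ) ρ
    nonemptyʳ : ∀ {a ρ} → OnR nonemptyʳ (a ∷ ρ) (a ∷ ρ)

  on-r? : ∀ o ρ {G : Word m → Set} → (∀ ρ → Dec (G ρ)) → Dec (∃[ ρ′ ] OnR o ρ ρ′ × G ρ′)
  on-r? nonemptyʳ []      G? = no λ ()
  on-r? nonemptyʳ (a ∷ ρ) G? =
    map′ (λ g → _ , nonemptyʳ , g) (λ { (_ , nonemptyʳ , g) → g }) (G? (a ∷ ρ))
  on-r? (onʳ a)   []      G? = no λ ()
  on-r? (onʳ a)   (b ∷ ρ) G? =
    map′ (λ { (refl , g) → _ , readʳ , g }) (λ { (_ , readʳ , g) → refl , g }) (a ≟ᶠ b ×-dec G? ρ)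
  on-r? idle      ρ       G? = no λ ()
  on-r? emptyˡ    ρ       G? = no λ ()
  on-r? nonemptyˡ ρ       G? = no λ ()
  on-r? (onˡ _)   ρ       G? = no λ ()

  signed-receive? : ∀ o ρ x y {G : Word m → Debts → Word m → Set} → (∀ ρ x y → Dec (G ρ x y)) →
                    Dec (∃[ ρ′ ] ∃[ x′ ] ∃[ y′ ]
                         SignedReceive o (ρ , x , y) (ρ′ , x′ , y′) × G ρ′ x′ y′)
  signed-receive? o ρ x y G? = map′
    (λ { (inj₁ (_ , _ , b , g)) → _ , _ , _ , borrow b , g
       ; (inj₂ (_ , readʳ , g)) → _ , _ , _ , readʳ , g
       ; (inj₂ (_ , nonemptyʳ , g)) → _ , _ , _ , nonemptyʳ , g })
    (λ { (_ , _ , _ , borrow b , g) → inj₁ (_ , _ , b , g)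
       ; (_ , _ , _ , readʳ , g) → inj₂ (_ , readʳ , g)
       ; (_ , _ , _ , nonemptyʳ , g) → inj₂ (_ , nonemptyʳ , g) })
    (borrow? o x y (G? ρ) ⊎-dec on-r? o ρ (λ ρ → G? ρ x y))

  settle? : ∀ y {G : Bool → Word m → Set} → (∀ b y → Dec (G b y)) →
            Dec (∃[ b′ ] ∃[ y′ ] Settle y b′ y′ × G b′ y′)
  settle? []      G? =
    map′ (λ g → _ , _ , clear , g) (λ { (_ , _ , clear , g) → g }) (G? false [])
  settle? (a ∷ y) G? = map′
    (λ { (inj₁ g) → _ , _ , clear , g ; (inj₂ (inj₁ g)) → _ , _ , keep , g
       ; (inj₂ (inj₂ g)) → _ , _ , drop , g })
    (λ { (_ , _ , clear , g) → inj₁ g ; (_ , _ , keep , g) → inj₂ (inj₁ g)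
       ; (_ , _ , drop , g) → inj₂ (inj₂ g) })
    (G? false (a ∷ y) ⊎-dec G? true (a ∷ y) ⊎-dec G? true y)

  sync? : ∀ p q (ρ : Word m) (x : Debts) y {G : SignedConfig → Set} → (∀ d → Dec (G d)) →
          Dec (∃[ p′ ] ∃[ q′ ] ∃[ b′ ] ∃[ y′ ]
               (ρ ≡ [] × x ≡ []) × Sync p q p′ q′ × Settle y b′ y′ × G (p′ , b′ , q′ , [] , [] , y′))
  sync? p q (_ ∷ _) x       y G? = no λ { (_ , _ , _ , _ , (() , _) , _) }
  sync? p q []      (_ ∷ _) y G? = no λ { (_ , _ , _ , _ , (_ , ()) , _) }
  sync? p q []      []      y G? = map′
    (λ (_ , _ , e , _ , _ , t , g) → _ , _ , _ , _ , (refl , refl) , e , t , g)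
    (λ (_ , _ , _ , _ , _ , e , t , g) → _ , _ , e , _ , _ , t , g)
    (existsᵖ? λ p′ → existsᵠ? λ q′ →
      Sync? p q p′ q′ ×-dec settle? y (λ b y → G? (p′ , b , q′ , [] , [] , y)))

  signed-successor? : ∀ c {G : SignedConfig → Set} → (∀ d → Dec (G d)) → Dec (∃[ d ] SignedStep c d × G d)
  signed-successor? (p , b , q , ρ , x , y) G? = map′
    (λ { (inj₁ (_ , _ , e , g)) → _ , transmit e , g
       ; (inj₂ (inj₁ (_ , _ , e , _ , _ , _ , _ , s , g))) → _ , send e s , g
       ; (inj₂ (inj₂ (inj₁ (_ , _ , e , _ , _ , _ , r , g)))) → _ , receive e r , g
       ; (inj₂ (inj₂ (inj₂ (_ , _ , _ , _ , (refl , refl) , e , t , g)))) → _ , sync e t , g })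
    (λ { (_ , transmit e , g)  → inj₁ (_ , _ , e , g)
       ; (_ , send e s , g)    → inj₂ (inj₁ (_ , _ , e , _ , _ , _ , _ , s , g))
       ; (_ , receive e r , g) → inj₂ (inj₂ (inj₁ (_ , _ , e , _ , _ , _ , r , g)))
       ; (_ , sync e t , g)    → inj₂ (inj₂ (inj₂ (_ , _ , _ , _ , (refl , refl) , e , t , g))) })
    ( any? (λ a → existsᵖ? λ p′ → SRule? p (onʳ a) p′ ×-dec G? (p′ , b , q , ρ ++ a ∷ [] , x , y))
    ⊎-dec existsᵒ? (λ o → existsᵖ? λ p′ → SRule? p o p′ ×-dec
                 signed-send? o b ρ x y (λ b ρ x y → G? (p′ , b , q , ρ , x , y)))
    ⊎-dec existsᵒ? (λ o → existsᵠ? λ q′ → RRule? q o q′ ×-dec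
                 signed-receive? o ρ x y (λ ρ x y → G? (p , b , q′ , ρ , x , y)))
    ⊎-dec sync? p q ρ x y G?)

  capped-successor? : ∀ c {G : SignedConfig → Set} → (∀ d → Dec (G d)) → Dec (∃[ d ] CappedStep c d × G d)
  capped-successor? c G? = map′ (λ (_ , s , l , g) → _ , (s , l) , g) (λ (_ , (s , l) , g) → _ , s , l , g)
    (signed-successor? c (λ d → length (ρ-of d) ≤? 1 ×-dec G? d))

  _≟ᶜ_ : DecidableEquality SignedConfig
  _≟ᶜ_ = Product.≡-dec _≟ᵖ_
        (Product.≡-dec Bool._≟_
        (Product.≡-dec _≟ᵠ_
        (Product.≡-dec (≡-dec _≟ᶠ_) (Product.≡-dec (≡-dec _≟ᶠ_) (≡-dec _≟ᶠ_)))))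

  path⇒star : ∀ {n c d} → Path CappedStep n c d → Star CappedStep c d
  path⇒star []      = ε
  path⇒star (s ∷ p) = s ◅ path⇒star p

  star⇒path : ∀ {c d} → Star CappedStep c d → ∃[ n ] Path CappedStep n c d
  star⇒path ε       = _ , []
  star⇒path (s ◅ r) = _ , s ∷ proj₂ (star⇒path r)

  channel-reachable? : ∀ p q p′ q′ → Dec (Star ChannelStep (p , q , [] , []) (p′ , q′ , [] , []))
  channel-reachable? p q p′ q′ = map′
    [ sound , sound ]′ complete (reachable true ⊎-dec reachable false)
    where
    reachable : ∀ b → Dec (∃[ n ] Path CappedStep n (p , false , q , [] , [] , []) (p′ , b , q′ , [] , [] , []))
    reachable b = reachable? cuttable _≟ᶜ_ capped-successor?
    sound : ∀ {b} → ∃[ n ] Path CappedStep n (p , false , q , [] , [] , []) (p′ , b , q′ , [] , [] , []) →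
            Star ChannelStep (p , q , [] , []) (p′ , q′ , [] , [])
    sound (_ , r) = realise (gmap id proj₁ (path⇒star r))
    complete : Star ChannelStep (p , q , [] , []) (p′ , q′ , [] , []) → _ ⊎ _
    complete r with signed {b = false} (inj₂ refl) r
    ... | [] , [] , r′ with capped r′
    ...   | true  , r″ = inj₁ (star⇒path r″)
    ...   | false , r″ = inj₂ (star⇒path r″)

-- Position automata of regular expressions

module Automaton (m : ℕ) where
  private
    decPoset = DecTotalOrder.decPoset (≤-decTotalOrder m)
  open Text.Regex.Base (DecPoset.preorder decPoset)
  open Text.Regex.Properties decPoset using ([]∈?_; _∈ᴿ?_; _∉ᴿ?_)

  -- Glushkov's construction: one state for each letter occurrence and no empty moves, so that every
  -- move of the automaton is one write or one read.
  Position : Exp → Set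
  Position ε       = ⊥
  Position [ _ ]   = ⊤
  Position [^ _ ]  = ⊤
  Position (e ∣ f) = Position e ⊎ Position f
  Position (e ∙ f) = Position e ⊎ Position f
  Position (e ⋆)   = Position e

  First : ∀ e → Fin m → Position e → Set
  First [ rs ]  a _        = Any (a ∈ᴿ_) rs
  First [^ rs ] a _        = All (a ∉ᴿ_) rs
  First (e ∣ f) a (inj₁ s) = First e a s
  First (e ∣ f) a (inj₂ s) = First f a s
  First (e ∙ f) a (inj₁ s) = First e a s
  First (e ∙ f) a (inj₂ s) = [] ∈ e × First f a s
  First (e ⋆)   a s        = First e a s

  Last : ∀ e → Position e → Set
  Last [ _ ]   _        = ⊤
  Last [^ _ ]  _        = ⊤
  Last (e ∣ f) (inj₁ s) = Last e s
  Last (e ∣ f) (inj₂ s) = Last f s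
  Last (e ∙ f) (inj₁ s) = Last e s × [] ∈ f
  Last (e ∙ f) (inj₂ s) = Last f s
  Last (e ⋆)   s        = Last e s

  Follow : ∀ e → Position e → Fin m → Position e → Set
  Follow [ _ ]   _        _ _        = ⊥
  Follow [^ _ ]  _        _ _        = ⊥
  Follow (e ∣ f) (inj₁ s) a (inj₁ t) = Follow e s a t
  Follow (e ∣ f) (inj₂ s) a (inj₂ t) = Follow f s a t
  Follow (e ∣ f) _        _ _        = ⊥
  Follow (e ∙ f) (inj₁ s) a (inj₁ t) = Follow e s a t
  Follow (e ∙ f) (inj₁ s) a (inj₂ t) = Last e s × First f a t
  Follow (e ∙ f) (inj₂ s) a (inj₁ t) = ⊥
  Follow (e ∙ f) (inj₂ s) a (inj₂ t) = Follow f s a t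
  Follow (e ⋆)   s        a t        = Follow e s a t ⊎ Last e s × First e a t

  position-finite : ∀ e → Finite (Position e)
  position-finite ε       = finite-⊥
  position-finite [ _ ]   = finite-⊤
  position-finite [^ _ ]  = finite-⊤
  position-finite (e ∣ f) = finite-⊎ (position-finite e) (position-finite f)
  position-finite (e ∙ f) = finite-⊎ (position-finite e) (position-finite f)
  position-finite (e ⋆)   = position-finite e

  first? : ∀ e a s → Dec (First e a s)
  first? [ rs ]  a _        = Any.any? (a ∈ᴿ?_) rs
  first? [^ rs ] a _        = All.all? (a ∉ᴿ?_) rs
  first? (e ∣ f) a (inj₁ s) = first? e a s
  first? (e ∣ f) a (inj₂ s) = first? f a s
  first? (e ∙ f) a (inj₁ s) = first? e a s
  first? (e ∙ f) a (inj₂ s) = []∈? e ×-dec first? f a s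
  first? (e ⋆)   a s        = first? e a s

  last? : ∀ e s → Dec (Last e s)
  last? [ _ ]   _        = yes tt
  last? [^ _ ]  _        = yes tt
  last? (e ∣ f) (inj₁ s) = last? e s
  last? (e ∣ f) (inj₂ s) = last? f s
  last? (e ∙ f) (inj₁ s) = last? e s ×-dec []∈? f
  last? (e ∙ f) (inj₂ s) = last? f s
  last? (e ⋆)   s        = last? e s

  follow? : ∀ e s a t → Dec (Follow e s a t)
  follow? [ _ ]   _        _ _        = no λ ()
  follow? [^ _ ]  _        _ _        = no λ ()
  follow? (e ∣ f) (inj₁ s) a (inj₁ t) = follow? e s a t
  follow? (e ∣ f) (inj₂ s) a (inj₂ t) = follow? f s a t
  follow? (e ∣ f) (inj₁ _) _ (inj₂ _) = no λ ()
  follow? (e ∣ f) (inj₂ _) _ (inj₁ _) = no λ ()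
  follow? (e ∙ f) (inj₁ s) a (inj₁ t) = follow? e s a t
  follow? (e ∙ f) (inj₁ s) a (inj₂ t) = last? e s ×-dec first? f a t
  follow? (e ∙ f) (inj₂ s) a (inj₁ t) = no λ ()
  follow? (e ∙ f) (inj₂ s) a (inj₂ t) = follow? f s a t
  follow? (e ⋆)   s        a t        = follow? e s a t ⊎-dec last? e s ×-dec first? e a t

  data From (e : Exp) : Position e → Word m → Set where
    stop : ∀ {s} → Last e s → From e s []
    step : ∀ {s a t w} → Follow e s a t → From e t w → From e s (a ∷ w)

  data Accepts (e : Exp) : Word m → Set where
    empty : [] ∈ e → Accepts e []
    start : ∀ {a s w} → First e a s → From e s w → Accepts e (a ∷ w)

  from-∣ˡ : ∀ {e f s w} → From e s w → From (e ∣ f) (inj₁ s) w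
  from-∣ˡ (stop l)   = stop l
  from-∣ˡ (step g r) = step g (from-∣ˡ r)

  from-∣ʳ : ∀ {e f s w} → From f s w → From (e ∣ f) (inj₂ s) w
  from-∣ʳ (stop l)   = stop l
  from-∣ʳ (step g r) = step g (from-∣ʳ r)

  from-∙ʳ : ∀ {e f s w} → From f s w → From (e ∙ f) (inj₂ s) w
  from-∙ʳ (stop l)   = stop l
  from-∙ʳ (step g r) = step g (from-∙ʳ r)

  from-∙ˡ : ∀ {e f s v w} → From e s v → Accepts f w → From (e ∙ f) (inj₁ s) (v ++ w)
  from-∙ˡ (stop l)   (empty n)   = stop (l , n)
  from-∙ˡ (stop l)   (start g r) = step (l , g) (from-∙ʳ r)
  from-∙ˡ (step g r) b           = step g (from-∙ˡ r b)

  from-⋆ : ∀ {e s v w} → From e s v → Accepts (e ⋆) w → From (e ⋆) s (v ++ w)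
  from-⋆ (stop l)   (empty n)   = stop l
  from-⋆ (stop l)   (start g r) = step (inj₂ (l , g)) r
  from-⋆ (step g r) b           = step (inj₁ g) (from-⋆ r b)

  accepts-∙ : ∀ {e f v w} → v ∈ e → Accepts e v → Accepts f w → Accepts (e ∙ f) (v ++ w)
  accepts-∙ i (empty _)   (empty n)   = empty (prod ([] ++ᵃ []) i n)
  accepts-∙ i (empty n)   (start g r) = start (n , g) (from-∙ʳ r)
  accepts-∙ i (start g r) b           = start g (from-∙ˡ r b)

  complete : ∀ {e w} → w ∈ e → Accepts e w
  complete ε               = empty ε
  complete [ r ]           = start r (stop tt)
  complete [^ r ]          = start r (stop tt)
  complete (sum (inj₁ i)) with complete i
  ... | empty n   = empty (sum (inj₁ n))
  ... | start g r = start g (from-∣ˡ r)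
  complete (sum (inj₂ i)) with complete i
  ... | empty n   = empty (sum (inj₂ n))
  ... | start g r = start g (from-∣ʳ r)
  complete (prod ap i j) with refl ← break ap = accepts-∙ i (complete i) (complete j)
  complete (star (sum (inj₁ ε))) = empty (star (sum (inj₁ ε)))
  complete (star (sum (inj₂ (prod ap i j)))) with refl ← break ap | complete i
  ... | empty _   = complete j
  ... | start g r = start g (from-⋆ r (complete j))

  from-∣ˡ⁻ : ∀ {e f s w} → From (e ∣ f) (inj₁ s) w → From e s w
  from-∣ˡ⁻ (stop l) = stop l
  from-∣ˡ⁻ (step {t = inj₁ _} g r) = step g (from-∣ˡ⁻ r)

  from-∣ʳ⁻ : ∀ {e f s w} → From (e ∣ f) (inj₂ s) w → From f s w
  from-∣ʳ⁻ (stop l) = stop l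
  from-∣ʳ⁻ (step {t = inj₂ _} g r) = step g (from-∣ʳ⁻ r)

  from-∙ʳ⁻ : ∀ {e f s w} → From (e ∙ f) (inj₂ s) w → From f s w
  from-∙ʳ⁻ (stop l) = stop l
  from-∙ʳ⁻ (step {t = inj₂ _} g r) = step g (from-∙ʳ⁻ r)

  from-∙ˡ⁻ : ∀ {e f s w} → From (e ∙ f) (inj₁ s) w →
             ∃[ u ] ∃[ v ] w ≡ u ++ v × From e s u × Accepts f v
  from-∙ˡ⁻ (stop (l , n)) = [] , [] , refl , stop l , empty n
  from-∙ˡ⁻ (step {a = a} {t = inj₁ _} g r) =
    let u , v , eq , r′ , i = from-∙ˡ⁻ r in a ∷ u , v , cong (a ∷_) eq , step g r′ , i
  from-∙ˡ⁻ (step {t = inj₂ _} (l , g) r) = [] , _ , refl , stop l , start g (from-∙ʳ⁻ r)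

  sound-first : ∀ e {a s w} → First e a s → From e s w → a ∷ w ∈ e

  sound : ∀ {e w} → Accepts e w → w ∈ e
  sound (empty n)   = n
  sound (start g r) = sound-first _ g r

  -- Soundness for e is an argument, since the recursion here is on the run and
  -- that of sound-first on the expression.
  from-⋆⁻ : ∀ {e s w} → (∀ {a s w} → First e a s → From e s w → a ∷ w ∈ e) →
            From (e ⋆) s w → ∃[ u ] ∃[ v ] w ≡ u ++ v × From e s u × v ∈ (e ⋆)
  from-⋆⁻ _ (stop l) = [] , [] , refl , stop l , star (sum (inj₁ ε))
  from-⋆⁻ h (step {a = a} (inj₁ g) r) =
    let u , v , eq , r′ , i = from-⋆⁻ h r in a ∷ u , v , cong (a ∷_) eq , step g r′ , i
  from-⋆⁻ h (step {a = a} (inj₂ (l , g)) r) with from-⋆⁻ h r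
  ... | u , v , refl , r′ , i =
    [] , _ , refl , stop l , star (sum (inj₂ (prod ((a ∷ u) ++ᵃ v) (h g r′) i)))

  sound-first [ _ ]   g (stop _) = [ g ]
  sound-first [^ _ ]  g (stop _) = [^ g ]
  sound-first (e ∣ f) {s = inj₁ _} g r = sum (inj₁ (sound-first e g (from-∣ˡ⁻ r)))
  sound-first (e ∣ f) {s = inj₂ _} g r = sum (inj₂ (sound-first f g (from-∣ʳ⁻ r)))
  sound-first (e ∙ f) {a} {s = inj₁ _} g r with from-∙ˡ⁻ r
  ... | u , .[] , refl , r′ , empty n = prod ((a ∷ u) ++ᵃ []) (sound-first e g r′) n
  ... | u , .(_ ∷ _) , refl , r′ , start g′ r″ =
    prod ((a ∷ u) ++ᵃ _) (sound-first e g r′) (sound-first f g′ r″)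
  sound-first (e ∙ f) {s = inj₂ _} (n , g) r = prod ([] ++ᵃ _) n (sound-first f g (from-∙ʳ⁻ r))
  sound-first (e ⋆) {a} g r with from-⋆⁻ (sound-first e) r
  ... | u , v , refl , r′ , i = star (sum (inj₂ (prod ((a ∷ u) ++ᵃ v) (sound-first e g r′) i)))

  State : Exp → Set
  State e = ⊤ ⊎ Position e

  pattern initial = inj₁ tt

  state-finite : ∀ e → Finite (State e)
  state-finite e = finite-⊎ finite-⊤ (position-finite e)

  Delta : ∀ e → State e → Fin m → State e → Set
  Delta e _        _ initial  = ⊥
  Delta e initial  a (inj₂ t) = First e a t
  Delta e (inj₂ s) a (inj₂ t) = Follow e s a t

  Final : ∀ e → State e → Set
  Final e initial  = [] ∈ e
  Final e (inj₂ s) = Last e s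

  delta? : ∀ e s a t → Dec (Delta e s a t)
  delta? e _        _ initial  = no λ ()
  delta? e initial  a (inj₂ t) = first? e a t
  delta? e (inj₂ s) a (inj₂ t) = follow? e s a t

  final? : ∀ e s → Dec (Final e s)
  final? e initial  = []∈? e
  final? e (inj₂ s) = last? e s

  data Run (e : Exp) : State e → Word m → State e → Set where
    []  : ∀ {s} → Run e s [] s
    _∷_ : ∀ {s a t w u} → Delta e s a t → Run e t w u → Run e s (a ∷ w) u

  run-snoc : ∀ {e s w t a u} → Run e s w t → Delta e t a u → Run e s (w ++ a ∷ []) u
  run-snoc []      d = d ∷ []
  run-snoc (c ∷ r) d = c ∷ run-snoc r d

  ∈⇒run : ∀ {e w} → w ∈ e → ∃[ s ] Run e initial w s × Final e s
  ∈⇒run i with complete i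
  ... | empty n   = _ , [] , n
  ... | start g r = let _ , R , f = go r in _ , g ∷ R , f
    where
    go : ∀ {e s w} → From e s w → ∃[ t ] Run e (inj₂ s) w t × Final e t
    go (stop l)   = _ , [] , l
    go (step g r) = let _ , R , f = go r in _ , g ∷ R , f

  run⇒∈ : ∀ {e w s} → Run e initial w s → Final e s → w ∈ e
  run⇒∈ [] f = f
  run⇒∈ (_∷_ {t = inj₂ _} d r) f = sound (start d (go r f))
    where
    go : ∀ {e s w t} → Run e (inj₂ s) w t → Final e t → From e s w
    go [] f = stop f
    go (_∷_ {t = inj₂ _} d r) f = step d (go r f)

-- The reduction

module Rules (m : ℕ) where
  open Text.Regex.Properties (DecTotalOrder.decPoset (≤-decTotalOrder m)) using ([]∈?_)
  open Finite (finite-op {m}) using () renaming (_≟_ to _≟ᵒ_)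

  communication : Channel → Fin m → Op m
  communication Channel.r = onʳ
  communication Channel.l = onˡ

  -- nothing stands for the emptiness test on r.
  test-effect : Channel → ∀ {A : Set} → Dec A → Maybe (Op m)
  test-effect Channel.r (yes _) = nothing
  test-effect Channel.r (no _)  = just nonemptyʳ
  test-effect Channel.l (yes _) = just emptyˡ
  test-effect Channel.l (no _)  = just nonemptyˡ

  -- Among the two kinds of tests the emptiness tests are those passed by the
  -- empty word.
  effect : Channel → Act m → Maybe (Op m)
  effect c (comm nothing)  = just idle
  effect c (comm (just a)) = just (communication c a)
  effect c (test R)        = test-effect c ([]∈? R)

  Fires : ∀ {n} → List (Rule m n) → Fin n → Maybe (Op m) → Fin n → Set
  Fires Δ p o p′ = Any (λ (p₁ , c , α , p₂) → (p₁ , effect c α , p₂) ≡ (p , o , p′)) Δ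

  fires? : ∀ {n} (Δ : List (Rule m n)) p o p′ → Dec (Fires Δ p o p′)
  fires? Δ p o p′ =
    Any.any? (λ _ → Product.≡-dec _≟ᶠ_ (Product.≡-dec (Maybe.≡-dec _≟ᵒ_) _≟ᶠ_) _ _) Δ

  fires : ∀ {n} {Δ : List (Rule m n)} {p c α p′} → (p , c , α , p′) ∈ˡ Δ → Fires Δ p (effect c α) p′
  fires = Any.map λ { refl → refl }

  empty-test : ∀ {R : Reg m} → ZNTest (test R) → ⟦ R ⟧ [] → ∀ {w} → ⟦ R ⟧ w → w ≡ []
  empty-test (inj₁ (to , _)) _ i = to i
  empty-test (inj₂ (to , _)) e _ = contradiction refl (to e)

  nonempty-test : ∀ {R : Reg m} → ZNTest (test R) → ¬ ⟦ R ⟧ [] → ∀ {a v} → ⟦ R ⟧ (a ∷ v)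
  nonempty-test (inj₁ (_ , from)) n = contradiction (from refl) n
  nonempty-test (inj₂ (_ , from)) n = from λ ()

module Reduction (S : UCST) (zn : UCST[Z,N] S)
                 (p-in p-fi : Fin (UCST.n₁ S)) (q-in q-fi : Fin (UCST.n₂ S))
                 (U V U′ V′ : Reg (UCST.m S)) where
  open UCST S
  open Rules m
  open Automaton m
  open Text.Regex.Properties (DecTotalOrder.decPoset (≤-decTotalOrder m)) using ([]∈?_)

  -- Sender first writes V to l and U to r. Receiver finally reads U′ from r and
  -- V′ from l, Sender having stopped before the latter.

  SenderState ReceiverState : Set
  SenderState   = State V ⊎ State U ⊎ Fin n₁ ⊎ ⊤
  ReceiverState = ⊤ ⊎ Fin n₂ ⊎ State U′ ⊎ State V′

  pattern fill-l s  = inj₁ s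
  pattern fill-r s  = inj₂ (inj₁ s)
  pattern sender p  = inj₂ (inj₂ (inj₁ p))
  pattern done      = inj₂ (inj₂ (inj₂ tt))
  pattern wait      = inj₁ tt
  pattern receiver q = inj₂ (inj₁ q)
  pattern drain-r s = inj₂ (inj₂ (inj₁ s))
  pattern drain-l s = inj₂ (inj₂ (inj₂ s))

  data SRule : SenderState → Op m → SenderState → Set where
    fillˡ : ∀ {s a t} → Delta V s a t → SRule (fill-l s) (onˡ a) (fill-l t)
    fillʳ : ∀ {s a t} → Delta U s a t → SRule (fill-r s) (onʳ a) (fill-r t)
    begin : ∀ {s} → Final U s → SRule (fill-r s) idle (sender p-in)
    rule  : ∀ {p o p′} → Fires Δ₁ p (just o) p′ → SRule (sender p) o (sender p′)

  data RRule : ReceiverState → Op m → ReceiverState → Set where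
    rule   : ∀ {q o q′} → Fires Δ₂ q (just o) q′ → RRule (receiver q) o (receiver q′)
    finish : RRule (receiver q-fi) idle (drain-r initial)
    drainʳ : ∀ {s a t} → Delta U′ s a t → RRule (drain-r s) (onʳ a) (drain-r t)
    drainˡ : ∀ {s a t} → Delta V′ s a t → RRule (drain-l s) (onˡ a) (drain-l t)

  -- Joint moves need r empty, which dictates the order: r is filled only after `start` and drained
  -- completely before `stop`. Receiver waits while l is filled, lest a test on l see a part of the
  -- content only. It need not wait for r, since emptiness tests on r are enabled only between
  -- `sender` and `receiver` states.
  data Sync : SenderState → ReceiverState → SenderState → ReceiverState → Set where
    start : ∀ {s} → Final V s → Sync (fill-l s) wait (fill-r initial) (receiver q-in)
    sender-rule : ∀ {p p′ q} → Fires Δ₁ p nothing p′ →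
                  Sync (sender p) (receiver q) (sender p′) (receiver q)
    receiver-rule : ∀ {p q q′} → Fires Δ₂ q nothing q′ →
                    Sync (sender p) (receiver q) (sender p) (receiver q′)
    stop : ∀ {s} → Final U′ s → Sync (sender p-fi) (drain-r s) done (drain-l initial)

  sender-finite : Finite SenderState
  sender-finite = finite-⊎ (state-finite V) (finite-⊎ (state-finite U) (finite-⊎ finite-Fin finite-⊤))

  receiver-finite : Finite ReceiverState
  receiver-finite = finite-⊎ finite-⊤ (finite-⊎ finite-Fin (finite-⊎ (state-finite U′) (state-finite V′)))

  open Finite sender-finite   using () renaming (_≟_ to _≟ᵖ_)
  open Finite receiver-finite using () renaming (_≟_ to _≟ᵠ_)
  open Finite (finite-op {m}) using () renaming (_≟_ to _≟ᵒ_; exists? to existsᵒ?)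

  exists-state? : ∀ e {G : State e → Set} → (∀ s → Dec (G s)) → Dec (∃[ s ] G s)
  exists-state? e = Finite.exists? (state-finite e)

  SRule? : ∀ p o p′ → Dec (SRule p o p′)
  SRule? p o p′ = map′
    (λ { (inj₁ (_ , _ , _ , d , refl)) → fillˡ d
       ; (inj₂ (inj₁ (_ , _ , _ , d , refl))) → fillʳ d
       ; (inj₂ (inj₂ (inj₁ (_ , f , refl)))) → begin f
       ; (inj₂ (inj₂ (inj₂ (_ , _ , _ , f , refl)))) → rule f })
    (λ { (fillˡ d) → inj₁ (_ , _ , _ , d , refl)
       ; (fillʳ d) → inj₂ (inj₁ (_ , _ , _ , d , refl))
       ; (begin f) → inj₂ (inj₂ (inj₁ (_ , f , refl)))
       ; (rule f)  → inj₂ (inj₂ (inj₂ (_ , _ , _ , f , refl))) })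
    ( exists-state? V (λ s → any? λ a → exists-state? V λ t →
        delta? V s a t ×-dec (p , o , p′) ≟ (fill-l s , onˡ a , fill-l t))
    ⊎-dec exists-state? U (λ s → any? λ a → exists-state? U λ t →
        delta? U s a t ×-dec (p , o , p′) ≟ (fill-r s , onʳ a , fill-r t))
    ⊎-dec exists-state? U (λ s → final? U s ×-dec (p , o , p′) ≟ (fill-r s , idle , sender p-in))
    ⊎-dec any? (λ p₁ → existsᵒ? λ o₁ → any? λ p₂ →
        fires? Δ₁ p₁ (just o₁) p₂ ×-dec (p , o , p′) ≟ (sender p₁ , o₁ , sender p₂)))
    where
    _≟_ = Product.≡-dec _≟ᵖ_ (Product.≡-dec _≟ᵒ_ _≟ᵖ_)

  RRule? : ∀ q o q′ → Dec (RRule q o q′)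
  RRule? q o q′ = map′
    (λ { (inj₁ (_ , _ , _ , f , refl)) → rule f
       ; (inj₂ (inj₁ refl)) → finish
       ; (inj₂ (inj₂ (inj₁ (_ , _ , _ , d , refl)))) → drainʳ d
       ; (inj₂ (inj₂ (inj₂ (_ , _ , _ , d , refl)))) → drainˡ d })
    (λ { (rule f)   → inj₁ (_ , _ , _ , f , refl)
       ; finish     → inj₂ (inj₁ refl)
       ; (drainʳ d) → inj₂ (inj₂ (inj₁ (_ , _ , _ , d , refl)))
       ; (drainˡ d) → inj₂ (inj₂ (inj₂ (_ , _ , _ , d , refl))) })
    ( any? (λ q₁ → existsᵒ? λ o₁ → any? λ q₂ →
        fires? Δ₂ q₁ (just o₁) q₂ ×-dec (q , o , q′) ≟ (receiver q₁ , o₁ , receiver q₂))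
    ⊎-dec (q , o , q′) ≟ (receiver q-fi , idle , drain-r initial)
    ⊎-dec exists-state? U′ (λ s → any? λ a → exists-state? U′ λ t →
        delta? U′ s a t ×-dec (q , o , q′) ≟ (drain-r s , onʳ a , drain-r t))
    ⊎-dec exists-state? V′ (λ s → any? λ a → exists-state? V′ λ t →
        delta? V′ s a t ×-dec (q , o , q′) ≟ (drain-l s , onˡ a , drain-l t)))
    where
    _≟_ = Product.≡-dec _≟ᵠ_ (Product.≡-dec _≟ᵒ_ _≟ᵠ_)

  Sync? : ∀ p q p′ q′ → Dec (Sync p q p′ q′)
  Sync? p q p′ q′ = map′
    (λ { (inj₁ (_ , f , refl)) → start f
       ; (inj₂ (inj₁ (_ , _ , _ , f , refl))) → sender-rule f
       ; (inj₂ (inj₂ (inj₁ (_ , _ , _ , f , refl)))) → receiver-rule f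
       ; (inj₂ (inj₂ (inj₂ (_ , f , refl)))) → stop f })
    (λ { (start f)         → inj₁ (_ , f , refl)
       ; (sender-rule f)   → inj₂ (inj₁ (_ , _ , _ , f , refl))
       ; (receiver-rule f) → inj₂ (inj₂ (inj₁ (_ , _ , _ , f , refl)))
       ; (stop f)          → inj₂ (inj₂ (inj₂ (_ , f , refl))) })
    ( exists-state? V (λ s → final? V s ×-dec
        (p , q , p′ , q′) ≟ (fill-l s , wait , fill-r initial , receiver q-in))
    ⊎-dec any? (λ p₁ → any? λ p₂ → any? λ q₁ → fires? Δ₁ p₁ nothing p₂ ×-dec
        (p , q , p′ , q′) ≟ (sender p₁ , receiver q₁ , sender p₂ , receiver q₁))
    ⊎-dec any? (λ p₁ → any? λ q₁ → any? λ q₂ → fires? Δ₂ q₁ nothing q₂ ×-dec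
        (p , q , p′ , q′) ≟ (sender p₁ , receiver q₁ , sender p₁ , receiver q₂))
    ⊎-dec exists-state? U′ (λ s → final? U′ s ×-dec
        (p , q , p′ , q′) ≟ (sender p-fi , drain-r s , done , drain-l initial)))
    where
    _≟_ = Product.≡-dec _≟ᵖ_ (Product.≡-dec _≟ᵠ_ (Product.≡-dec _≟ᵖ_ _≟ᵠ_))

  system : System
  system = record
    { m = m ; P = SenderState ; Q = ReceiverState
    ; P-finite = sender-finite ; Q-finite = receiver-finite
    ; SRule = SRule ; RRule = RRule ; Sync = Sync
    ; SRule? = SRule? ; RRule? = RRule? ; Sync? = Sync? }

  open Semantics′ system using (ChannelStep; LocalStep; send; local; sync; receive; lose)
  open Semantics S using (Step; ReliableStep; LossStep; loss; sender-test; sender-write; receiver-test; receiver-read; G-G-Reach)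
    renaming (Run to Run₀; Config to Config₀)

  -- From runs of the given system to runs of the reduced one

  Run₁ : Rel (SenderState × ReceiverState × Contents m) 0ℓ
  Run₁ = Star ChannelStep

  fill-l-run : ∀ {s w t v} → Run V s w t → Run₁ (fill-l s , wait , [] , v) (fill-l t , wait , [] , v ++ w)
  fill-l-run {v = v} [] rewrite ++-identityʳ v = ε
  fill-l-run {w = a ∷ w} {v = v} (d ∷ r) =
    subst (λ z → Run₁ _ (_ , _ , _ , z)) (++-assoc v (a ∷ []) w) (send (fillˡ d) writeˡ ◅ fill-l-run r)

  fill-r-run : ∀ {s w t q u v} → Run U s w t → Run₁ (fill-r s , q , u , v) (fill-r t , q , u ++ w , v)
  fill-r-run {u = u} [] rewrite ++-identityʳ u = ε
  fill-r-run {w = a ∷ w} {u = u} (d ∷ r) =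
    subst (λ z → Run₁ _ (_ , _ , z , _)) (++-assoc u (a ∷ []) w) (send (fillʳ d) writeʳ ◅ fill-r-run r)

  drain-r-run : ∀ {s w t p v} → Run U′ s w t → Run₁ (p , drain-r s , w , v) (p , drain-r t , [] , v)
  drain-r-run []      = ε
  drain-r-run (d ∷ r) = local (receive (drainʳ d) readʳ) ◅ drain-r-run r

  drain-l-run : ∀ {s w t p u} → Run V′ s w t → Run₁ (p , drain-l s , u , w) (p , drain-l t , u , [])
  drain-l-run []      = ε
  drain-l-run (d ∷ r) = local (receive (drainˡ d) readˡ) ◅ drain-l-run r

  embed : Config₀ → SenderState × ReceiverState × Contents m
  embed (p , q , k) = sender p , receiver q , k

  embed-sender-test : ∀ {p p′ q c R u v} → (p , c , test R , p′) ∈ˡ Δ₁ → ⟦ R ⟧ (content c (u , v)) →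
                      Run₁ (embed (p , q , u , v)) (embed (p′ , q , u , v))
  embed-sender-test {c = c} {R} i t with []∈? R | fires i
  embed-sender-test {c = Channel.r} i t | yes e | f with refl ← empty-test (All.lookup (proj₁ zn) i) e t =
    sync (sender-rule f) ◅ ε
  embed-sender-test {c = Channel.r} {u = []}    i t | no n | f = contradiction t n
  embed-sender-test {c = Channel.r} {u = _ ∷ _} i t | no n | f = send (rule f) nonemptyʳ ◅ ε
  embed-sender-test {c = Channel.l} i t | yes e | f with refl ← empty-test (All.lookup (proj₁ zn) i) e t =
    send (rule f) emptyˡ ◅ ε
  embed-sender-test {c = Channel.l} {v = []}    i t | no n | f = contradiction t n
  embed-sender-test {c = Channel.l} {v = _ ∷ _} i t | no n | f = send (rule f) nonemptyˡ ◅ ε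

  embed-receiver-test : ∀ {p q q′ c R u v} → (q , c , test R , q′) ∈ˡ Δ₂ → ⟦ R ⟧ (content c (u , v)) →
                        Run₁ (embed (p , q , u , v)) (embed (p , q′ , u , v))
  embed-receiver-test {c = c} {R} i t with []∈? R | fires i
  embed-receiver-test {c = Channel.r} i t | yes e | f with refl ← empty-test (All.lookup (proj₂ zn) i) e t =
    sync (receiver-rule f) ◅ ε
  embed-receiver-test {c = Channel.r} {u = []}    i t | no n | f = contradiction t n
  embed-receiver-test {c = Channel.r} {u = _ ∷ _} i t | no n | f = local (receive (rule f) nonemptyʳ) ◅ ε
  embed-receiver-test {c = Channel.l} i t | yes e | f with refl ← empty-test (All.lookup (proj₂ zn) i) e t =
    local (receive (rule f) emptyˡ) ◅ ε
  embed-receiver-test {c = Channel.l} {v = []}    i t | no n | f = contradiction t n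
  embed-receiver-test {c = Channel.l} {v = _ ∷ _} i t | no n | f = local (receive (rule f) nonemptyˡ) ◅ ε

  embed-step : ∀ {c d} → Step c d → Run₁ (embed c) (embed d)
  embed-step (inj₁ (sender-test i t)) = embed-sender-test i t
  embed-step (inj₁ (sender-write {c = Channel.r} {just a} i)) = send (rule (fires i)) writeʳ ◅ ε
  embed-step (inj₁ (sender-write {c = Channel.l} {just a} i)) = send (rule (fires i)) writeˡ ◅ ε
  embed-step (inj₁ (sender-write {c = Channel.r} {nothing} {u , v} i)) rewrite ++-identityʳ u =
    send (rule (fires i)) idle ◅ ε
  embed-step (inj₁ (sender-write {c = Channel.l} {nothing} {u , v} i)) rewrite ++-identityʳ v =
    send (rule (fires i)) idle ◅ ε
  embed-step (inj₁ (receiver-test i t)) = embed-receiver-test i t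
  embed-step (inj₁ (receiver-read {c = Channel.r} {just a} i refl)) =
    local (receive (rule (fires i)) readʳ) ◅ ε
  embed-step (inj₁ (receiver-read {c = Channel.l} {just a} i refl)) =
    local (receive (rule (fires i)) readˡ) ◅ ε
  embed-step (inj₁ (receiver-read {c = Channel.r} {nothing} i refl)) =
    local (receive (rule (fires i)) idle) ◅ ε
  embed-step (inj₁ (receiver-read {c = Channel.l} {nothing} i refl)) =
    local (receive (rule (fires i)) idle) ◅ ε
  embed-step (inj₂ (loss v₁ a v₂)) = local (lose (++⁺ (⊆-refl {x = v₁}) (a ∷ʳ ⊆-refl))) ◅ ε

  embed-run : ∀ {c d} → Run₀ c d → Run₁ (embed c) (embed d)
  embed-run ε       = ε
  embed-run (s ◅ r) = embed-step s ◅◅ embed-run r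

  reduce : G-G-Reach p-in p-fi q-in q-fi U V U′ V′ →
           ∃[ s ] Final V′ s × Run₁ (fill-l initial , wait , [] , []) (done , drain-l s , [] , [])
  reduce (_ , _ , _ , _ , i , j , i′ , j′ , r) =
    let _ , R , f = ∈⇒run i
        _ , T , g = ∈⇒run j
        _ , R′ , f′ = ∈⇒run i′
        t , T′ , g′ = ∈⇒run j′
    in t , g′ ,
       fill-l-run T ◅◅ sync (start g) ◅ fill-r-run R ◅◅ send (begin f) idle ◅ embed-run r ◅◅
       local (receive finish idle) ◅ drain-r-run R′ ◅◅ sync (stop f′) ◅ drain-l-run T′

  -- From runs of the reduced system to runs of the given one

  lose-run : ∀ {p q u v v′} w → v′ ⊆ v → Run₀ (p , q , u , w ++ v) (p , q , u , w ++ v′)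
  lose-run w [] = ε
  lose-run {v = _ ∷ v} w (a ∷ʳ i) = inj₂ (loss w a v) ◅ lose-run w i
  lose-run {v = a ∷ v} {_ ∷ v′} w (refl ∷ i) =
    subst₂ (λ y z → Run₀ (_ , _ , _ , y) (_ , _ , _ , z)) (++-assoc w (a ∷ []) v) (++-assoc w (a ∷ []) v′)
      (lose-run (w ++ a ∷ []) i)

  sender-step : ∀ {p c α p′ o q k k′} → (p , c , α , p′) ∈ˡ Δ₁ → effect c α ≡ just o → Send o k k′ →
                Run₀ (p , q , k) (p′ , q , k′)
  sender-step {c = Channel.r} {comm nothing} {k = u , v} i refl idle =
    subst (λ z → Run₀ _ (_ , _ , z , v)) (++-identityʳ u) (inj₁ (sender-write i) ◅ ε)
  sender-step {c = Channel.l} {comm nothing} {k = u , v} i refl idle =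
    subst (λ z → Run₀ _ (_ , _ , u , z)) (++-identityʳ v) (inj₁ (sender-write i) ◅ ε)
  sender-step {c = Channel.r} {comm (just _)} i refl writeʳ = inj₁ (sender-write i) ◅ ε
  sender-step {c = Channel.l} {comm (just _)} i refl writeˡ = inj₁ (sender-write i) ◅ ε
  sender-step {c = c} {test R} i e s with []∈? R
  sender-step {c = Channel.r} {test R} i refl nonemptyʳ | no n =
    inj₁ (sender-test i (nonempty-test (All.lookup (proj₁ zn) i) n)) ◅ ε
  sender-step {c = Channel.l} {test R} i refl emptyˡ | yes e = inj₁ (sender-test i e) ◅ ε
  sender-step {c = Channel.l} {test R} i refl nonemptyˡ | no n =
    inj₁ (sender-test i (nonempty-test (All.lookup (proj₁ zn) i) n)) ◅ ε

  receiver-step : ∀ {q c α q′ o p k k′} → (q , c , α , q′) ∈ˡ Δ₂ → effect c α ≡ just o → Receive o k k′ →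
                  Run₀ (p , q , k) (p , q′ , k′)
  receiver-step {c = Channel.r} {comm nothing} i refl idle = inj₁ (receiver-read i refl) ◅ ε
  receiver-step {c = Channel.l} {comm nothing} i refl idle = inj₁ (receiver-read i refl) ◅ ε
  receiver-step {c = Channel.r} {comm (just _)} i refl readʳ = inj₁ (receiver-read i refl) ◅ ε
  receiver-step {c = Channel.l} {comm (just _)} i refl readˡ = inj₁ (receiver-read i refl) ◅ ε
  receiver-step {c = c} {test R} i e s with []∈? R
  receiver-step {c = Channel.r} {test R} i refl nonemptyʳ | no n =
    inj₁ (receiver-test i (nonempty-test (All.lookup (proj₂ zn) i) n)) ◅ ε
  receiver-step {c = Channel.l} {test R} i refl emptyˡ | yes e = inj₁ (receiver-test i e) ◅ ε
  receiver-step {c = Channel.l} {test R} i refl nonemptyˡ | no n =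
    inj₁ (receiver-test i (nonempty-test (All.lookup (proj₂ zn) i) n)) ◅ ε

  sender-fires : ∀ {p o p′ q k k′} → Fires Δ₁ p (just o) p′ → Send o k k′ → Run₀ (p , q , k) (p′ , q , k′)
  sender-fires f s with find f
  ... | (_ , c , α , _) , i , e with refl ← cong proj₁ e | refl ← cong (proj₂ ∘ proj₂) e =
    sender-step i (cong (proj₁ ∘ proj₂) e) s

  receiver-fires : ∀ {q o q′ p k k′} → Fires Δ₂ q (just o) q′ → Receive o k k′ → Run₀ (p , q , k) (p , q′ , k′)
  receiver-fires f s with find f
  ... | (_ , c , α , _) , i , e with refl ← cong proj₁ e | refl ← cong (proj₂ ∘ proj₂) e =
    receiver-step i (cong (proj₁ ∘ proj₂) e) s

  emptyʳ-effect : ∀ c α → effect c α ≡ nothing → c ≡ Channel.r × ∃[ R ] α ≡ test R × ⟦ R ⟧ []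
  emptyʳ-effect c (comm nothing)  ()
  emptyʳ-effect c (comm (just _)) ()
  emptyʳ-effect c (test R) e with []∈? R
  emptyʳ-effect Channel.r (test R) refl | yes i = refl , R , refl , i
  emptyʳ-effect Channel.r (test R) ()   | no _
  emptyʳ-effect Channel.l (test R) ()   | yes _
  emptyʳ-effect Channel.l (test R) ()   | no _

  sender-emptyʳ : ∀ {p p′ q v} → Fires Δ₁ p nothing p′ → Run₀ (p , q , [] , v) (p′ , q , [] , v)
  sender-emptyʳ f with find f
  ... | (_ , c , α , _) , i , e with refl ← cong proj₁ e | refl ← cong (proj₂ ∘ proj₂) e
                     | emptyʳ-effect c α (cong (proj₁ ∘ proj₂) e)
  ...   | refl , _ , refl , t = inj₁ (sender-test i t) ◅ ε

  receiver-emptyʳ : ∀ {q q′ p v} → Fires Δ₂ q nothing q′ → Run₀ (p , q , [] , v) (p , q′ , [] , v)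
  receiver-emptyʳ f with find f
  ... | (_ , c , α , _) , i , e with refl ← cong proj₁ e | refl ← cong (proj₂ ∘ proj₂) e
                     | emptyʳ-effect c α (cong (proj₁ ∘ proj₂) e)
  ...   | refl , _ , refl , t = inj₁ (receiver-test i t) ◅ ε

  -- Letters already drained still stand on r in the given system. Only an emptiness test on r could
  -- notice them, and this is not among the operations; hence Sender may run on while r is drained.
  send-prepend : ∀ {o u v u′ v′} w → Send {m} o (u , v) (u′ , v′) → Send o (w ++ u , v) (w ++ u′ , v′)
  send-prepend w idle = idle
  send-prepend w (writeʳ {a} {u} {v}) =
    subst (λ z → Send (onʳ a) (w ++ u , v) (z , v)) (++-assoc w u (a ∷ [])) writeʳ
  send-prepend w       writeˡ    = writeˡ
  send-prepend []      nonemptyʳ = nonemptyʳ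
  send-prepend (_ ∷ w) nonemptyʳ = nonemptyʳ
  send-prepend w       emptyˡ    = emptyˡ
  send-prepend w       nonemptyˡ = nonemptyˡ

  receive-append : ∀ {o u v u′ v′} w → Receive {m} o (u , v) (u′ , v′) → Receive o (u ++ w , v) (u′ ++ w , v′)
  receive-append w idle      = idle
  receive-append w readʳ     = readʳ
  receive-append w readˡ     = readˡ
  receive-append w nonemptyʳ = nonemptyʳ
  receive-append w emptyˡ    = emptyˡ
  receive-append w nonemptyˡ = nonemptyˡ

  -- The word records what has been drained, which in the given system is still at the front of r.
  data Receiving : ReceiverState → Fin n₂ → Word m → Set where
    running  : ∀ {q} → Receiving (receiver q) q []
    draining : ∀ {w s} → Run U′ initial w s → Receiving (drain-r s) q-fi w

  Initially : Word m → Word m → Config₀ → Set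
  Initially u v c = Run₀ (p-in , q-in , u , v) c

  -- While r is being filled, any word z may still follow.
  data Reflects : SenderState → ReceiverState → Contents m → Set where
    filling-l : ∀ {s v v₀} → Run V initial v₀ s → v ⊆ v₀ → Reflects (fill-l s) wait ([] , v)
    filling-r : ∀ {s q̂ u v v₀ u₀ q w} → ⟦ V ⟧ v₀ → Run U initial u₀ s → Receiving q̂ q w →
                (∀ z → Initially (u₀ ++ z) v₀ (p-in , q , w ++ u ++ z , v)) →
                Reflects (fill-r s) q̂ (u , v)
    running : ∀ {p q̂ u v v₀ u₀ q w} → ⟦ V ⟧ v₀ → ⟦ U ⟧ u₀ → Receiving q̂ q w →
              Initially u₀ v₀ (p , q , w ++ u , v) → Reflects (sender p) q̂ (u , v)
    draining-l : ∀ {s v v₀ u₀ w w′} → ⟦ V ⟧ v₀ → ⟦ U ⟧ u₀ → ⟦ U′ ⟧ w → Run V′ initial w′ s →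
                 Initially u₀ v₀ (p-fi , q-fi , w , w′ ++ v) → Reflects done (drain-l s) ([] , v)

  receiving-step : ∀ {q̂ q w o q̂′} → Receiving q̂ q w → RRule q̂ o q̂′ → ∃[ q′ ] ∃[ w′ ] Receiving q̂′ q′ w′ ×
                   (∀ {p u v u′ v′} → Receive o (u , v) (u′ , v′) → Run₀ (p , q , w ++ u , v) (p , q′ , w′ ++ u′ , v′))
  receiving-step running      (rule f)   = _ , _ , running , receiver-fires f
  receiving-step running      finish     = _ , _ , draining [] , λ { idle → ε }
  receiving-step (draining {w} R) (drainʳ {a = a} d) = _ , _ , draining (run-snoc R d) , λ { (readʳ {u = u} {v}) →
    subst (λ z → Run₀ (_ , _ , w ++ a ∷ u , v) (_ , _ , z , v)) (sym (++-assoc w (a ∷ []) u)) ε }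

  reflects-step : ∀ {p q k p′ q′ k′} → ChannelStep (p , q , k) (p′ , q′ , k′) → Reflects p q k → Reflects p′ q′ k′
  reflects-step (send (fillˡ d) writeˡ) (filling-l R i) = filling-l (run-snoc R d) (++⁺ i ⊆-refl)
  reflects-step (send (fillʳ {a = a} d) (writeʳ {u = u})) (filling-r {u₀ = u₀} {w = w} j R Q r) =
    filling-r j (run-snoc R d) Q
      (λ z → subst₂ (λ x y → Initially x _ (_ , _ , w ++ y , _))
               (sym (++-assoc u₀ (a ∷ []) z)) (sym (++-assoc u (a ∷ []) z)) (r (a ∷ z)))
  reflects-step (send (begin f) idle) (filling-r {u = u} {u₀ = u₀} {w = w} j R Q r) =
    running j (run⇒∈ R f) Q
      (subst₂ (λ x y → Initially x _ (_ , _ , w ++ y , _)) (++-identityʳ u₀) (++-identityʳ u) (r []))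
  reflects-step (send (rule f) s) (running {w = w} j i Q r) = running j i Q (r ◅◅ sender-fires f (send-prepend w s))
  reflects-step (local (receive e s)) (filling-r j R Q r) =
    let _ , _ , Q′ , f = receiving-step Q e in
    filling-r j R Q′ (λ z → r z ◅◅ f (receive-append z s))
  reflects-step (local (receive e s)) (running j i Q r) =
    let _ , _ , Q′ , f = receiving-step Q e in running j i Q′ (r ◅◅ f s)
  reflects-step (local (receive (drainˡ {a = a} d) (readˡ {v = v}))) (draining-l {w′ = w′} j i i′ R r) =
    draining-l j i i′ (run-snoc R d) (subst (λ z → Initially _ _ (_ , _ , _ , z)) (sym (++-assoc w′ (a ∷ []) v)) r)
  reflects-step (local (lose l)) (filling-l R i) = filling-l R (⊆-trans l i)
  reflects-step (local (lose l)) (filling-r j R Q r) = filling-r j R Q (λ z → r z ◅◅ lose-run [] l)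
  reflects-step (local (lose l)) (running j i Q r) = running j i Q (r ◅◅ lose-run [] l)
  reflects-step (local (lose l)) (draining-l {w′ = w′} j i i′ R r) = draining-l j i i′ R (r ◅◅ lose-run w′ l)
  reflects-step (sync (start f)) (filling-l R i) =
    -- Letters lost during the filling of l are lost from the initial content instead.
    filling-r (run⇒∈ R f) [] running (λ z → lose-run [] i)
  reflects-step (sync (sender-rule f)) (running j i running r) = running j i running (r ◅◅ sender-emptyʳ f)
  reflects-step (sync (receiver-rule f)) (running j i running r) = running j i running (r ◅◅ receiver-emptyʳ f)
  reflects-step (sync (stop f)) (running j i (draining {w} R) r) =
    draining-l j i (run⇒∈ R f) [] (subst (λ z → Initially _ _ (_ , _ , z , _)) (++-identityʳ w) r)

  reflects-run : ∀ {p q k p′ q′ k′} → Run₁ (p , q , k) (p′ , q′ , k′) → Reflects p q k → Reflects p′ q′ k′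
  reflects-run ε       i = i
  reflects-run (s ◅ r) i = reflects-run r (reflects-step s i)

  unreduce : ∀ {s} → Final V′ s → Run₁ (fill-l initial , wait , [] , []) (done , drain-l s , [] , []) →
             G-G-Reach p-in p-fi q-in q-fi U V U′ V′
  unreduce f r with reflects-run r (filling-l [] [])
  ... | draining-l {w′ = w′} j i i′ R r′ =
    _ , _ , _ , w′ , i , j , i′ , run⇒∈ R f , subst (λ z → Initially _ _ (_ , _ , _ , z)) (++-identityʳ w′) r′

  decide : Dec (G-G-Reach p-in p-fi q-in q-fi U V U′ V′)
  decide = map′ (λ (_ , f , r) → unreduce f r) reduce
    (exists-state? V′ λ s → final? V′ s ×-dec
      channel-reachable? system (fill-l initial) wait done (drain-l s))

theorem4p1 : (S : UCST) → UCST[Z,N] S →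
    (p-in p-fi : Fin (UCST.n₁ S)) (q-in q-fi : Fin (UCST.n₂ S)) →
    (U V U′ V′ : Reg (UCST.m S)) →
    Dec (Semantics.G-G-Reach S p-in p-fi q-in q-fi U V U′ V′)
theorem4p1 = Reduction.decide
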